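{- Let $p$ be a prime, $f\ge1$, $q=p^f$. Suppose that for every integer $k$ with $1\le k\le q-1$, every $d\ge1$, every $e\ge0$ with $p^e\mid d$ and $p^e\ge q$, and every $[g_q(k,d),k,d]_q$ Griesmer code $C$, the integer $p^{e+1}/q$ divides $\mathrm{wt}(c)$ for all $c\in C$. Then the same conclusion holds for every $k\ge1$: for every $[g_q(k,d),k,d]_q$ Griesmer code $C$ and every $e$ with $p^e\mid d$ and $p^e\ge q$, $p^{e+1}/q$ divides $\mathrm{wt}(c)$ for all $c\in C$.
   Context: An $[n,k,d]_q$ code is a $k$-dimensional subspace of $\mathbb{F}_q^n$ with minimum nonzero Hamming weight $d$; $\mathrm{wt}(c)$ is the number of nonzero coordinates of $c$. $g_q(k,d)=\sum_{i=0}^{k-1}\lceil d/q^i\rceil$, and a code of length $g_q(k,d)$ is a Griesmer code. Codes are assumed to have full length. -}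

module Defs where

open import Level using (Level; _⊔_) renaming (suc to lsuc)
open import Data.Nat as ℕ using (ℕ; zero; suc)
open import Data.Nat.Divisibility using (_∣_)
open import Data.Fin as Fin using (Fin)
open import Data.Product using (Σ; ∃; _×_; _,_)
open import Relation.Nullary using (¬_; Dec; yes; no)
open import Relation.Binary.PropositionalEquality using (_≡_)
open import Algebra.Bundles using (CommutativeRing)

record FiniteField (c ℓ : Level) (q : ℕ) : Set (lsuc (c ⊔ ℓ)) where
  field
    commRing : CommutativeRing c ℓ
  open CommutativeRing commRing public
  field
    _≟_      : (a b : Carrier) → Dec (a ≈ b)
    1≉0      : ¬ (1# ≈ 0#)
    inverse  : (a : Carrier) → ¬ (a ≈ 0#) → Σ Carrier (λ b → a * b ≈ 1#)
    enum     : Fin q → Carrier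
    enum-sur : (a : Carrier) → Σ (Fin q) (λ i → enum i ≈ a)
    enum-inj : (i j : Fin q) → enum i ≈ enum j → i ≡ j

-- ceiling division ⌈ m / n ⌉ (n = 0 gives a junk value 0; never used with n = 0)
⌈_/_⌉ : ℕ → ℕ → ℕ
⌈ m / zero ⌉  = 0
⌈ m / suc n ⌉ = (m ℕ.+ n) ℕ./ suc n

griesmer : ℕ → ℕ → ℕ → ℕ
griesmer q zero    d = 0
griesmer q (suc k) d = griesmer q k d ℕ.+ ⌈ d / q ℕ.^ k ⌉

module _ {c ℓ : Level} {q : ℕ} (F : FiniteField c ℓ q) where
  open FiniteField F

  sumF : (k : ℕ) → (Fin k → Carrier) → Carrier
  sumF zero    v = 0#
  sumF (suc k) v = v Fin.zero + sumF k (λ i → v (Fin.suc i))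

  wt : {n : ℕ} → (Fin n → Carrier) → ℕ
  wt {zero}  v = 0
  wt {suc n} v with v Fin.zero ≟ 0#
  ... | yes _ = wt {n} (λ j → v (Fin.suc j))
  ... | no  _ = suc (wt {n} (λ j → v (Fin.suc j)))

  IsZeroVec : {n : ℕ} → (Fin n → Carrier) → Set ℓ
  IsZeroVec v = ∀ j → v j ≈ 0#

  -- An [n,k]_q linear code, given by a generator matrix whose k rows are
  -- linearly independent (so the code, the row space, has dimension k).
  record LinearCode (n k : ℕ) : Set (c ⊔ ℓ) where
    field
      G         : Fin k → Fin n → Carrier
      rows-indep : (x : Fin k → Carrier) →
                   IsZeroVec (λ j → sumF k (λ i → x i * G i j)) → IsZeroVec x

    encode : (Fin k → Carrier) → Fin n → Carrier
    encode x j = sumF k (λ i → x i * G i j)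

    _∈C : (Fin n → Carrier) → Set (c ⊔ ℓ)
    v ∈C = Σ (Fin k → Carrier) (λ x → ∀ j → v j ≈ encode x j)

  open LinearCode public

  record Code (n k d : ℕ) : Set (c ⊔ ℓ) where
    field
      lin      : LinearCode n k
      min-wt   : (v : Fin n → Carrier) → _∈C lin v → ¬ IsZeroVec v → d ℕ.≤ wt v
      attains  : Σ (Fin n → Carrier) (λ v → _∈C lin v × ¬ IsZeroVec v × wt v ≡ d)
      full-len : (j : Fin n) → Σ (Fin n → Carrier) (λ v → _∈C lin v × ¬ (v j ≈ 0#))

  -- Property of Theorem 6.3: for all e with p^e ∣ d, p^e ≥ q, and all
  -- codewords v, p^{e+1}/q divides wt(v).  The quotient p^{e+1}/q is
  -- expressed as the (unique) m with m * q ≡ p^{e+1}.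
  DivProp : (p n k d : ℕ) → Code n k d → Set (c ⊔ ℓ)
  DivProp p n k d C = (e : ℕ) → p ℕ.^ e ∣ d → q ℕ.≤ p ℕ.^ e →
    (m : ℕ) → m ℕ.* q ≡ p ℕ.^ suc e →
    (v : Fin n → Carrier) → _∈C (Code.lin C) v → m ∣ wt v

{-# OPTIONS --safe #-}
-- Induction on the dimension k.  Write q = p^f, e = f + j and Δ = p^(j+1), and regard a code as
-- the list of its columns.  Pigeonhole produces points P carrying ⌈d/q^(k-1)⌉ columns; by the
-- Griesmer bound the messages orthogonal to P form a Griesmer code of dimension k - 1, hence have
-- weights divisible by Δ: call P good.  For messages u and v,
--   Σ_α wt(u + α v) + wt(v) = q (wt(v) + weight of u in the residual code of v),
-- so Δ divides wt(u) once it divides wt(v) and the right-hand side and every u + α v with α ≠ 0 is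
-- orthogonal to a good point, that is, once the ratios v·P / u·P at good points P take all nonzero
-- values.
--   * If j < f, then Δ ∣ q and every v serves.  Every hyperplane misses a good point, so k ≥ q
--     independent good points allow all q ratios to be prescribed.
--   * If j ≥ f, then q² ∣ d.  For k = 2 the weight is constant.  For k ≥ 3 there is a
--     three-dimensional subcode V of constant weight d, and for v in V the right-hand side is
--     controlled by the induction hypothesis on the residual code.  Every nonzero z in F³ is, up
--     to a scalar, the restriction to V of a good point, and a second moment count over V yields
--     a v attaining all nonzero ratios.
module Submission where

open import Defs
open import Level using (Level; 0ℓ)
open import Data.Nat using (ℕ; _^_; _≤_; _∸_)
open import Data.Nat using (zero; suc; pred; _+_; _*_; _<_; z≤n; s≤s; NonZero; >-nonZero; nonTrivial⇒n>1)
open import Data.Nat.Primality using (Prime; prime⇒nonTrivial)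
open import Data.Nat.Properties hiding (_≟_)
open import Data.Nat.Divisibility
open import Data.Nat.DivMod
open import Data.Nat.Tactic.RingSolver using (solve-∀)
open import Data.Fin as Fin using (Fin)
open import Data.Fin.Properties as Finₚ using ()
open import Data.Vec.Base as Vec using (Vec; []; _∷_; head; tail; take; drop; lookup; _++_)
open import Data.Vec.Properties using (≡-dec; take++drop≡id; lookup∘tabulate)
open import Data.List.Base as List using (List; []; _∷_; map; length; filter; allFin; concatMap)
open import Data.List.Properties using (length-map; length-tabulate; tabulate-lookup; filter-notAll)
open import Data.List.Membership.Propositional using (_∈_)
open import Data.List.Membership.Propositional.Properties using (∈-tabulate⁺)
open import Data.List.Relation.Unary.Any as Any using (here; there)
open import Data.Product using (Σ; ∃; _×_; _,_; proj₁; proj₂)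
open import Data.Sum using (_⊎_; inj₁; inj₂)
open import Function using (_∘_; id)
open import Algebra.Bundles using (CommutativeRing; RawRing)
open import Algebra.Core using (Op₁; Op₂)
open import Algebra.Morphism.Structures using (IsRingMonomorphism)
import Algebra.Morphism.RingMonomorphism as RingMonomorphism
import Algebra.Solver.Ring.NaturalCoefficients.Default as RingSolver
open import Algebra.Structures using (IsCommutativeRing)
open import Relation.Nullary using (¬_; Dec; yes; no; contradiction)
open import Relation.Nullary.Decidable using (¬?; _×-dec_; decidable-stable)
open import Relation.Binary.PropositionalEquality

-- Dimension three is dictated by the second moment. Let V have dimension r. If each v in V missed a
-- nonzero ratio, Cauchy-Schwarz over the remaining q - 2 values would force at least (q-1)^2
-- q^(2r-2)/(q-2) collisions per v, while the average over v is at most (q-1)(q^(2r-2) + q^r). After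
-- dividing by q - 1, the excess q^(2r-2)/(q-2) has to beat q^r, that is, q^(r-2) > q - 2. This
-- fails for planes once q ≥ 3 and holds for r = 3. Constant weight in dimension r is obtained from
-- q^(r-1) dividing d, so r = 3 asks for q^2. The thresholds fit together: in a constant-weight V at
-- least d/q^2 columns lie over each point of F³, and sharing them among its q^(k-3) lifts leaves
-- some lift with ⌈d/q^(k-1)⌉ columns, exactly what makes a point good.

-- Finite sums, indicator functions and enumerations

∑ : {A : Set} → List A → (A → ℕ) → ℕ
∑ []       f = 0
∑ (x ∷ xs) f = f x + ∑ xs f

-- The Iverson bracket, in which the counting arguments are written.
⟦_⟧ : {P : Set} → Dec P → ℕ
⟦ yes _ ⟧ = 1
⟦ no  _ ⟧ = 0

⟦⟧-mono : {P Q : Set} (p : Dec P) (q : Dec Q) → (P → Q) → ⟦ p ⟧ ≤ ⟦ q ⟧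
⟦⟧-mono (yes a) (yes b) f = ≤-refl
⟦⟧-mono (yes a) (no ¬b) f = contradiction (f a) ¬b
⟦⟧-mono (no _)  _       f = z≤n

⟦⟧-cong : {P Q : Set} (p : Dec P) (q : Dec Q) → (P → Q) → (Q → P) → ⟦ p ⟧ ≡ ⟦ q ⟧
⟦⟧-cong p q f g = ≤-antisym (⟦⟧-mono p q f) (⟦⟧-mono q p g)

⟦⟧-yes : {P : Set} (p : Dec P) → P → ⟦ p ⟧ ≡ 1
⟦⟧-yes (yes _) a = refl
⟦⟧-yes (no ¬a) a = contradiction a ¬a

⟦⟧-no : {P : Set} (p : Dec P) → ¬ P → ⟦ p ⟧ ≡ 0
⟦⟧-no (yes a) ¬a = contradiction a ¬a
⟦⟧-no (no _)  _  = refl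

⟦⟧≤1 : {P : Set} (p : Dec P) → ⟦ p ⟧ ≤ 1
⟦⟧≤1 (yes _) = ≤-refl
⟦⟧≤1 (no _)  = z≤n

⟦¬⟧ : {P : Set} (p : Dec P) → ⟦ ¬? p ⟧ + ⟦ p ⟧ ≡ 1
⟦¬⟧ (yes _) = refl
⟦¬⟧ (no _)  = refl

module _ {A : Set} where

  ∑-cong : (xs : List A) {f g : A → ℕ} → (∀ x → f x ≡ g x) → ∑ xs f ≡ ∑ xs g
  ∑-cong []       h = refl
  ∑-cong (x ∷ xs) h = cong₂ _+_ (h x) (∑-cong xs h)

  ∑-mono : (xs : List A) {f g : A → ℕ} → (∀ x → f x ≤ g x) → ∑ xs f ≤ ∑ xs g
  ∑-mono []       h = z≤n
  ∑-mono (x ∷ xs) h = +-mono-≤ (h x) (∑-mono xs h)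

  ∑-+ : (xs : List A) (f g : A → ℕ) → ∑ xs (λ x → f x + g x) ≡ ∑ xs f + ∑ xs g
  ∑-+ []       f g = refl
  ∑-+ (x ∷ xs) f g = trans (cong (f x + g x +_) (∑-+ xs f g)) (interchange (f x) (g x) (∑ xs f) (∑ xs g))
    where
    interchange : ∀ a b c d → a + b + (c + d) ≡ a + c + (b + d)
    interchange = solve-∀

  ∑-* : (xs : List A) (c : ℕ) (f : A → ℕ) → ∑ xs (λ x → c * f x) ≡ c * ∑ xs f
  ∑-* []       c f = sym (*-zeroʳ c)
  ∑-* (x ∷ xs) c f = trans (cong (c * f x +_) (∑-* xs c f)) (sym (*-distribˡ-+ c (f x) (∑ xs f)))

  ∑-const : (xs : List A) (c : ℕ) → ∑ xs (λ _ → c) ≡ length xs * c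
  ∑-const []       c = refl
  ∑-const (x ∷ xs) c = cong (c +_) (∑-const xs c)

  ∑-zero : (xs : List A) {f : A → ℕ} → (∀ x → f x ≡ 0) → ∑ xs f ≡ 0
  ∑-zero xs h = trans (∑-cong xs h) (trans (∑-const xs 0) (*-zeroʳ (length xs)))

  ∑-++ : (xs ys : List A) (f : A → ℕ) → ∑ (xs List.++ ys) f ≡ ∑ xs f + ∑ ys f
  ∑-++ []       ys f = refl
  ∑-++ (x ∷ xs) ys f = trans (cong (f x +_) (∑-++ xs ys f)) (sym (+-assoc (f x) _ _))

  ∑-filter : {P : A → Set} (P? : ∀ x → Dec (P x)) (xs : List A) (f : A → ℕ) →
             (∀ x → ¬ P x → f x ≡ 0) → ∑ (filter P? xs) f ≡ ∑ xs f
  ∑-filter P? []       f h = refl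
  ∑-filter P? (x ∷ xs) f h with P? x
  ... | yes _  = cong (f x +_) (∑-filter P? xs f h)
  ... | no ¬px = trans (∑-filter P? xs f h) (cong (_+ ∑ xs f) (sym (h x ¬px)))

  length-filter-∑ : {P : A → Set} (P? : ∀ x → Dec (P x)) (xs : List A) →
                    length (filter P? xs) ≡ ∑ xs (λ x → ⟦ P? x ⟧)
  length-filter-∑ P? []       = refl
  length-filter-∑ P? (x ∷ xs) with P? x
  ... | yes _ = cong suc (length-filter-∑ P? xs)
  ... | no _  = length-filter-∑ P? xs

  length-split : {P : A → Set} (P? : ∀ x → Dec (P x)) (xs : List A) →
                 length (filter (λ x → ¬? (P? x)) xs) + ∑ xs (λ x → ⟦ P? x ⟧) ≡ length xs
  length-split P? xs = begin
    length (filter (λ x → ¬? (P? x)) xs) + ∑ xs (λ x → ⟦ P? x ⟧)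
      ≡⟨ cong (_+ ∑ xs (λ x → ⟦ P? x ⟧)) (length-filter-∑ (λ x → ¬? (P? x)) xs) ⟩
    ∑ xs (λ x → ⟦ ¬? (P? x) ⟧) + ∑ xs (λ x → ⟦ P? x ⟧)
      ≡⟨ ∑-+ xs _ _ ⟨
    ∑ xs (λ x → ⟦ ¬? (P? x) ⟧ + ⟦ P? x ⟧)
      ≡⟨ ∑-cong xs (λ x → ⟦¬⟧ (P? x)) ⟩
    ∑ xs (λ _ → 1)
      ≡⟨ ∑-const xs 1 ⟩
    length xs * 1
      ≡⟨ *-identityʳ _ ⟩
    length xs ∎
    where open ≡-Reasoning

  ∑-∣ : (xs : List A) {f : A → ℕ} {m : ℕ} → (∀ x → m ∣ f x) → m ∣ ∑ xs f
  ∑-∣ []       h = _ ∣0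
  ∑-∣ (x ∷ xs) h = ∣m∣n⇒∣m+n (h x) (∑-∣ xs h)

  ∑-≥∈ : {xs : List A} {x : A} (f : A → ℕ) → x ∈ xs → f x ≤ ∑ xs f
  ∑-≥∈ f (here refl) = m≤m+n _ _
  ∑-≥∈ {y ∷ _} f (there i) = ≤-trans (∑-≥∈ f i) (m≤n+m _ (f y))

module _ {A B : Set} where

  ∑-map : (h : A → B) (xs : List A) (f : B → ℕ) → ∑ (map h xs) f ≡ ∑ xs (f ∘ h)
  ∑-map h []       f = refl
  ∑-map h (x ∷ xs) f = cong (f (h x) +_) (∑-map h xs f)

  ∑-concatMap : (h : A → List B) (xs : List A) (f : B → ℕ) →
                ∑ (concatMap h xs) f ≡ ∑ xs (λ x → ∑ (h x) f)
  ∑-concatMap h []       f = refl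
  ∑-concatMap h (x ∷ xs) f =
    trans (∑-++ (h x) (concatMap h xs) f) (cong (∑ (h x) f +_) (∑-concatMap h xs f))

  ∑-comm : (xs : List A) (ys : List B) (f : A → B → ℕ) →
           ∑ xs (λ x → ∑ ys (f x)) ≡ ∑ ys (λ y → ∑ xs (λ x → f x y))
  ∑-comm []       ys f = sym (∑-zero ys (λ _ → refl))
  ∑-comm (x ∷ xs) ys f = trans (cong (∑ ys (f x) +_) (∑-comm xs ys f)) (sym (∑-+ ys _ _))

-- `once` is phrased as a sum so that it gives completeness and exact counting together.
record Enumeration (A : Set) : Set where
  field
    _≟_   : (x y : A) → Dec (x ≡ y)
    elems : List A
    once  : ∀ y → ∑ elems (λ x → ⟦ x ≟ y ⟧) ≡ 1

  ∑-point : (f : A → ℕ) (y : A) → ∑ elems (λ x → ⟦ x ≟ y ⟧ * f x) ≡ f y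
  ∑-point f y = begin
    ∑ elems (λ x → ⟦ x ≟ y ⟧ * f x) ≡⟨ ∑-cong elems at-y ⟩
    ∑ elems (λ x → f y * ⟦ x ≟ y ⟧) ≡⟨ ∑-* elems (f y) _ ⟩
    f y * ∑ elems (λ x → ⟦ x ≟ y ⟧) ≡⟨ cong (f y *_) (once y) ⟩
    f y * 1                         ≡⟨ *-identityʳ (f y) ⟩
    f y ∎
    where
    open ≡-Reasoning
    at-y : ∀ x → ⟦ x ≟ y ⟧ * f x ≡ f y * ⟦ x ≟ y ⟧
    at-y x with x ≟ y
    ... | yes refl = *-comm 1 (f x)
    ... | no _     = sym (*-zeroʳ (f y))

  complete : ∀ y → y ∈ elems
  complete y = go elems (once y)
    where
    go : ∀ xs → ∑ xs (λ x → ⟦ x ≟ y ⟧) ≡ 1 → y ∈ xs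
    go (x ∷ xs) h with x ≟ y
    ... | yes refl = here refl
    ... | no _     = there (go xs h)

  -- Instead of permuting the list, write `f (τ x)` as a sum over points `y`, exchange the sums and
  -- turn `y ≡ τ x` into `x ≡ σ y`.
  ∑-bijection : (f : A → ℕ) (τ σ : A → A) → (∀ x → τ (σ x) ≡ x) → (∀ x → σ (τ x) ≡ x) →
                ∑ elems (λ x → f (τ x)) ≡ ∑ elems f
  ∑-bijection f τ σ τσ στ = begin
    ∑ elems (λ x → f (τ x))
      ≡⟨ ∑-cong elems (λ x → sym (∑-point f (τ x))) ⟩
    ∑ elems (λ x → ∑ elems (λ y → ⟦ y ≟ τ x ⟧ * f y))
      ≡⟨ ∑-comm elems elems _ ⟩
    ∑ elems (λ y → ∑ elems (λ x → ⟦ y ≟ τ x ⟧ * f y))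
      ≡⟨ ∑-cong elems (λ y → ∑-cong elems (λ x → cong (_* f y) (⟦⟧-cong (y ≟ τ x) (x ≟ σ y)
           (λ e → trans (sym (στ x)) (cong σ (sym e)))
           (λ e → trans (sym (τσ y)) (cong τ (sym e)))))) ⟩
    ∑ elems (λ y → ∑ elems (λ x → ⟦ x ≟ σ y ⟧ * f y))
      ≡⟨ ∑-cong elems (λ y → ∑-point (λ _ → f y) (σ y)) ⟩
    ∑ elems f ∎
    where open ≡-Reasoning

  any? : {P : A → Set} → (∀ x → Dec (P x)) → Dec (∃ P)
  any? {P} P? = go elems complete
    where
    search : ∀ xs → (∃ P) ⊎ (∀ x → x ∈ xs → ¬ P x)
    search [] = inj₂ (λ _ ())
    search (x ∷ xs) with P? x | search xs
    ... | yes p | _      = inj₁ (x , p)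
    ... | no _  | inj₁ e = inj₁ e
    ... | no ¬p | inj₂ h = inj₂ λ { _ (here refl) → ¬p ; y (there i) → h y i }
    go : ∀ xs → (∀ x → x ∈ xs) → Dec (∃ P)
    go xs all with search xs
    ... | inj₁ e = yes e
    ... | inj₂ h = no (λ (x , p) → h x (all x) p)

  -- Isolates the weight of `u` within the total weight of a line in `cover`.
  ∑-∣-but : (f : A → ℕ) {m : ℕ} (y : A) → m ∣ ∑ elems f → (∀ x → x ≢ y → m ∣ f x) → m ∣ f y
  ∑-∣-but f {m} y total h =
    subst (m ∣_) (∑-point f y)
      (∣m+n∣m⇒∣n (subst (m ∣_) (trans (∑-cong elems split) (∑-+ elems _ _)) total)
        (∑-∣ elems others))
    where
    split : ∀ x → f x ≡ ⟦ ¬? (x ≟ y) ⟧ * f x + ⟦ x ≟ y ⟧ * f x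
    split x = trans (sym (*-identityˡ (f x)))
      (trans (cong (_* f x) (sym (⟦¬⟧ (x ≟ y)))) (*-distribʳ-+ (f x) ⟦ ¬? (x ≟ y) ⟧ ⟦ x ≟ y ⟧))
    others : ∀ x → m ∣ ⟦ ¬? (x ≟ y) ⟧ * f x
    others x with x ≟ y
    ... | yes _  = m ∣0
    ... | no x≢y = ∣n⇒∣m*n 1 (h x x≢y)

-- Ceilings and the Griesmer function

⌈/⌉-lower : ∀ m n .{{_ : NonZero n}} → m ≤ ⌈ m / n ⌉ * n
⌈/⌉-lower m (suc n) = +-cancelʳ-≤ n m _ (begin
  m + n                                         ≡⟨ m≡m%n+[m/n]*n (m + n) (suc n) ⟩
  (m + n) % suc n + ⌈ m / suc n ⌉ * suc n       ≤⟨ +-monoˡ-≤ _ (m%n≤n∸1) ⟩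
  n + ⌈ m / suc n ⌉ * suc n                     ≡⟨ +-comm n _ ⟩
  ⌈ m / suc n ⌉ * suc n + n                     ∎)
  where
  open ≤-Reasoning
  m%n≤n∸1 : (m + n) % suc n ≤ n
  m%n≤n∸1 = ≤-pred (m%n<n (m + n) (suc n))

⌈/⌉-least : ∀ m n x .{{_ : NonZero n}} → m ≤ x * n → ⌈ m / n ⌉ ≤ x
⌈/⌉-least m (suc n) x h = ≤-pred (m<n*o⇒m/o<n (begin-strict
  m + n         ≤⟨ +-monoˡ-≤ n h ⟩
  x * suc n + n <⟨ +-monoʳ-< (x * suc n) (n<1+n n) ⟩
  x * suc n + suc n ≡⟨ +-comm (x * suc n) (suc n) ⟩
  suc x * suc n ∎))
  where open ≤-Reasoning

⌈/⌉-mono : ∀ {m m'} n .{{_ : NonZero n}} → m ≤ m' → ⌈ m / n ⌉ ≤ ⌈ m' / n ⌉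
⌈/⌉-mono {m} {m'} n h = ⌈/⌉-least m n _ (≤-trans h (⌈/⌉-lower m' n))

⌈/⌉-exact : ∀ x n .{{_ : NonZero n}} → ⌈ n * x / n ⌉ ≡ x
⌈/⌉-exact x n = ≤-antisym (⌈/⌉-least (n * x) n x (≤-reflexive (*-comm n x)))
  (*-cancelʳ-≤ x _ n (≤-trans (≤-reflexive (*-comm x n)) (⌈/⌉-lower (n * x) n)))

⌈/⌉-pos : ∀ {m} n .{{_ : NonZero n}} → 1 ≤ m → 1 ≤ ⌈ m / n ⌉
⌈/⌉-pos {m} n h with ⌈ m / n ⌉ in eq
... | zero  = contradiction (≤-trans h (≤-trans (⌈/⌉-lower m n) (≤-reflexive (cong (_* n) eq)))) λ ()
... | suc _ = s≤s z≤n

-- Both sides are the least `x` with `d ≤ x * (m * n)`.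
⌈/⌉-nest : ∀ d m n .{{_ : NonZero m}} .{{_ : NonZero n}} .{{_ : NonZero (m * n)}} →
           ⌈ d / m * n ⌉ ≡ ⌈ ⌈ d / m ⌉ / n ⌉
⌈/⌉-nest d m n = ≤-antisym
  (⌈/⌉-least d (m * n) _ (begin
    d                                  ≤⟨ ⌈/⌉-lower d m ⟩
    ⌈ d / m ⌉ * m                      ≤⟨ *-monoˡ-≤ m (⌈/⌉-lower ⌈ d / m ⌉ n) ⟩
    ⌈ ⌈ d / m ⌉ / n ⌉ * n * m          ≡⟨ swap-factors ⌈ ⌈ d / m ⌉ / n ⌉ n m ⟩
    ⌈ ⌈ d / m ⌉ / n ⌉ * (m * n)        ∎))
  (⌈/⌉-least ⌈ d / m ⌉ n _ (⌈/⌉-least d m _ (begin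
    d                                  ≤⟨ ⌈/⌉-lower d (m * n) ⟩
    ⌈ d / m * n ⌉ * (m * n)            ≡⟨ swap-factors ⌈ d / m * n ⌉ n m ⟨
    ⌈ d / m * n ⌉ * n * m              ∎)))
  where
  open ≤-Reasoning
  swap-factors : ∀ a b c → a * b * c ≡ a * (c * b)
  swap-factors = solve-∀

module _ (q : ℕ) .{{_ : NonZero q}} where

  -- The definition splits off the last summand, which suits subcodes; residual codes need the first
  -- one split off.
  griesmer-rec : ∀ k d → griesmer q (suc k) d ≡ d + griesmer q k ⌈ d / q ⌉
  griesmer-rec zero    d = trans (⌈/1⌉ d) (sym (+-identityʳ d))
    where
    ⌈/1⌉ : ∀ m → ⌈ m / 1 ⌉ ≡ m
    ⌈/1⌉ m = trans (cong (λ x → ⌈ x / 1 ⌉) (sym (*-identityˡ m))) (⌈/⌉-exact m 1)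
  griesmer-rec (suc k) d = begin
    griesmer q (suc k) d + ⌈ d / q * q ^ k ⌉                    ≡⟨ cong₂ _+_ (griesmer-rec k d) (⌈/⌉-nest d q (q ^ k)) ⟩
    d + griesmer q k ⌈ d / q ⌉ + ⌈ ⌈ d / q ⌉ / q ^ k ⌉         ≡⟨ +-assoc d _ _ ⟩
    d + griesmer q (suc k) ⌈ d / q ⌉                            ∎
    where
    open ≡-Reasoning
    instance
      _ : NonZero (q ^ k)
      _ = m^n≢0 q k
      _ : NonZero (q * q ^ k)
      _ = m^n≢0 q (suc k)

  griesmer-mono : ∀ k {d d'} → d ≤ d' → griesmer q k d ≤ griesmer q k d'
  griesmer-mono zero    h = z≤n
  griesmer-mono (suc k) h = +-mono-≤ (griesmer-mono k h) (⌈/⌉-mono (q ^ k) {{m^n≢0 q k}} h)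

  griesmer-strict : ∀ k {d d'} → d < d' → griesmer q (suc k) d < griesmer q (suc k) d'
  griesmer-strict k {d} {d'} h = subst₂ _<_ (sym (griesmer-rec k d)) (sym (griesmer-rec k d'))
    (+-mono-<-≤ h (griesmer-mono k (⌈/⌉-mono q (<⇒≤ h))))

  -- The geometric sum q^r + … + 1, cleared of the denominator q - 1.
  griesmer-geometric : ∀ r d → pred q * griesmer q (suc r) (q ^ r * d) + d ≡ q ^ suc r * d
  griesmer-geometric zero d = begin
    pred q * griesmer q 1 (1 * d) + d  ≡⟨ cong (λ x → pred q * x + d) (griesmer-rec 0 (1 * d)) ⟩
    pred q * (1 * d + 0) + d           ≡⟨ alg (pred q) d ⟩
    suc (pred q) * 1 * d               ≡⟨ cong (λ x → x * 1 * d) (suc-pred q) ⟩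
    q ^ 1 * d                          ∎
    where
    open ≡-Reasoning
    alg : ∀ a b → a * (1 * b + 0) + b ≡ (1 + a) * 1 * b
    alg = solve-∀
  griesmer-geometric (suc r) d = begin
    pred q * griesmer q (2 + r) (q ^ suc r * d) + d
      ≡⟨ cong (λ x → pred q * x + d) (griesmer-rec (suc r) (q ^ suc r * d)) ⟩
    pred q * (q ^ suc r * d + griesmer q (suc r) ⌈ q ^ suc r * d / q ⌉) + d
      ≡⟨ cong (λ x → pred q * (q ^ suc r * d + griesmer q (suc r) x) + d)
           (trans (cong (λ x → ⌈ x / q ⌉) (*-assoc q (q ^ r) d)) (⌈/⌉-exact (q ^ r * d) q)) ⟩
    pred q * (q ^ suc r * d + griesmer q (suc r) (q ^ r * d)) + d
      ≡⟨ regroup (pred q) _ _ d ⟩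
    pred q * (q ^ suc r * d) + (pred q * griesmer q (suc r) (q ^ r * d) + d)
      ≡⟨ cong (pred q * (q ^ suc r * d) +_) (griesmer-geometric r d) ⟩
    pred q * (q ^ suc r * d) + q ^ suc r * d
      ≡⟨ collect (pred q) (q ^ suc r) d ⟩
    suc (pred q) * q ^ suc r * d
      ≡⟨ cong (λ x → x * q ^ suc r * d) (suc-pred q) ⟩
    q ^ suc (suc r) * d ∎
    where
    open ≡-Reasoning
    regroup : ∀ a b c e → a * (b + c) + e ≡ a * b + (a * c + e)
    regroup = solve-∀
    collect : ∀ a b e → a * (b * e) + b * e ≡ (1 + a) * b * e
    collect = solve-∀

-- Linear algebra over a field structure on Fin q

finEnumeration : ∀ n → Enumeration (Fin n)
finEnumeration n = record { _≟_ = Fin._≟_ ; elems = allFin n ; once = once n }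
  where
  ∑-tabulate : ∀ {n} {A : Set} (h : Fin n → A) (f : A → ℕ) → ∑ (List.tabulate h) f ≡ ∑ (allFin n) (f ∘ h)
  ∑-tabulate {zero}  h f = refl
  ∑-tabulate {suc n} h f = cong (f (h Fin.zero) +_)
    (trans (∑-tabulate (h ∘ Fin.suc) f) (sym (∑-tabulate Fin.suc (f ∘ h))))
  once : ∀ n (y : Fin n) → ∑ (allFin n) (λ x → ⟦ x Fin.≟ y ⟧) ≡ 1
  once (suc n) Fin.zero = cong suc (trans (∑-tabulate {n} Fin.suc _)
    (∑-zero (allFin n) (λ x → ⟦⟧-no (Fin.suc x Fin.≟ Fin.zero) λ ())))
  once (suc n) (Fin.suc y) = trans (∑-tabulate {n} Fin.suc _)
    (trans (∑-cong (allFin n) (λ x → ⟦⟧-cong (Fin.suc x Fin.≟ Fin.suc y) (x Fin.≟ y) Finₚ.suc-injective (cong Fin.suc)))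
      (once n y))

vecEnumeration : {A : Set} → Enumeration A → ∀ k → Enumeration (Vec A k)
vecEnumeration {A} E k = record { _≟_ = ≡-dec (Enumeration._≟_ E) ; elems = vecs k ; once = once k }
  where
  open Enumeration E using (elems; _≟_) renaming (once to onceA)
  vecs : ∀ k → List (Vec A k)
  vecs zero    = [] ∷ []
  vecs (suc k) = concatMap (λ a → List.map (a ∷_) (vecs k)) elems
  once : ∀ k (y : Vec A k) → ∑ (vecs k) (λ x → ⟦ ≡-dec _≟_ x y ⟧) ≡ 1
  once zero    []      = refl
  once (suc k) (b ∷ y) = begin
    ∑ (vecs (suc k)) (λ x → ⟦ ≡-dec _≟_ x (b ∷ y) ⟧)
      ≡⟨ ∑-concatMap _ elems _ ⟩
    ∑ elems (λ a → ∑ (List.map (a ∷_) (vecs k)) (λ x → ⟦ ≡-dec _≟_ x (b ∷ y) ⟧))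
      ≡⟨ ∑-cong elems (λ a → trans (∑-map (a ∷_) (vecs k) _)
           (trans (∑-cong (vecs k) (split a)) (∑-* (vecs k) ⟦ a ≟ b ⟧ _))) ⟩
    ∑ elems (λ a → ⟦ a ≟ b ⟧ * ∑ (vecs k) (λ x → ⟦ ≡-dec _≟_ x y ⟧))
      ≡⟨ ∑-cong elems (λ a → trans (cong (⟦ a ≟ b ⟧ *_) (once k y)) (*-identityʳ _)) ⟩
    ∑ elems (λ a → ⟦ a ≟ b ⟧)
      ≡⟨ onceA b ⟩
    1 ∎
    where
    open ≡-Reasoning
    split : ∀ a x → ⟦ ≡-dec _≟_ (a ∷ x) (b ∷ y) ⟧ ≡ ⟦ a ≟ b ⟧ * ⟦ ≡-dec _≟_ x y ⟧
    split a x with a ≟ b | ≡-dec _≟_ x y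
    ... | yes _ | yes _ = refl
    ... | yes _ | no _  = refl
    ... | no _  | _     = refl

record FinField (q : ℕ) : Set where
  infixl 6 _⊕_
  infixl 7 _⊗_
  infix  8 ⊖_
  field
    _⊕_ _⊗_           : Op₂ (Fin q)
    ⊖_                : Op₁ (Fin q)
    0F 1F             : Fin q
    isCommutativeRing : IsCommutativeRing _≡_ _⊕_ _⊗_ ⊖_ 0F 1F
    1≢0               : 1F ≢ 0F
    inverse           : ∀ a → a ≢ 0F → Σ (Fin q) (λ b → a ⊗ b ≡ 1F)

-- With `ρ` for q - 2 and `suc ρ` for q - 1, the counting identities avoid truncated subtraction.
module CodesOver (q ρ : ℕ) (q≡2+ρ : q ≡ 2 + ρ) (K : FinField q) where

  open FinField K

  instance
    q-nonZero : NonZero q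
    q-nonZero = >-nonZero (subst (0 <_) (sym q≡2+ρ) (s≤s z≤n))

  F : Set
  F = Fin q

  commutativeRing : CommutativeRing 0ℓ 0ℓ
  commutativeRing = record { isCommutativeRing = isCommutativeRing }

  open CommutativeRing commutativeRing using ()
    renaming ( +-identityˡ to ⊕-identityˡ; +-identityʳ to ⊕-identityʳ; +-assoc to ⊕-assoc; +-comm to ⊕-comm
             ; -‿inverseˡ to ⊖-inverseˡ; -‿inverseʳ to ⊖-inverseʳ; *-identityˡ to ⊗-identityˡ; *-identityʳ to ⊗-identityʳ
             ; zeroˡ to ⊗-zeroˡ; zeroʳ to ⊗-zeroʳ; *-comm to ⊗-comm; *-assoc to ⊗-assoc
             ; distribˡ to ⊗-distribˡ-⊕; distribʳ to ⊗-distribʳ-⊕ )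

  open RingSolver (CommutativeRing.commutativeSemiring commutativeRing) using (_:+_; _:*_; _:=_) renaming (solve to solveF)

  opaque
    𝔽 : Enumeration F
    𝔽 = finEnumeration q

    length-elems𝔽 : List.length (Enumeration.elems 𝔽) ≡ q
    length-elems𝔽 = length-tabulate {n = q} id

    𝕍 : ∀ k → Enumeration (Vec F k)
    𝕍 = vecEnumeration 𝔽

    ∑𝕍-zero : (f : Vec F 0 → ℕ) → ∑ (Enumeration.elems (𝕍 0)) f ≡ f []
    ∑𝕍-zero f = +-identityʳ (f [])

    ∑𝕍-suc : ∀ k (f : Vec F (suc k) → ℕ) → ∑ (Enumeration.elems (𝕍 (suc k))) f ≡
             ∑ (Enumeration.elems 𝔽) (λ a → ∑ (Enumeration.elems (𝕍 k)) (λ x → f (a ∷ x)))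
    ∑𝕍-suc k f = trans
      (∑-concatMap (λ a → List.map (a ∷_) (Enumeration.elems (𝕍 k))) (Enumeration.elems 𝔽) f)
      (∑-cong (Enumeration.elems 𝔽) (λ a → ∑-map (a ∷_) (Enumeration.elems (𝕍 k)) f))

  V : ℕ → Set
  V = Vec F

  elemsF : List F
  elemsF = Enumeration.elems 𝔽

  elemsV : ∀ k → List (V k)
  elemsV k = Enumeration.elems (𝕍 k)

  infix 4 _≟_ _≟ⱽ_
  _≟_ : (a b : F) → Dec (a ≡ b)
  _≟_ = Enumeration._≟_ 𝔽

  _≟ⱽ_ : ∀ {k} (x y : V k) → Dec (x ≡ y)
  _≟ⱽ_ {k} = Enumeration._≟_ (𝕍 k)

  infix 9 _⁻¹
  _⁻¹ : F → F
  a ⁻¹ with a ≟ 0F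
  ... | yes _  = 0F
  ... | no a≢0 = proj₁ (inverse a a≢0)

  ⁻¹-inverseʳ : ∀ {a} → a ≢ 0F → a ⊗ a ⁻¹ ≡ 1F
  ⁻¹-inverseʳ {a} a≢0 with a ≟ 0F
  ... | yes a≡0 = contradiction a≡0 a≢0
  ... | no a≢0' = proj₂ (inverse a a≢0')

  ⁻¹-cancelˡ : ∀ {a} → a ≢ 0F → ∀ b → a ⊗ (a ⁻¹ ⊗ b) ≡ b
  ⁻¹-cancelˡ {a} a≢0 b = trans (sym (⊗-assoc a (a ⁻¹) b)) (trans (cong (_⊗ b) (⁻¹-inverseʳ a≢0)) (⊗-identityˡ b))

  ⁻¹-cancelʳ : ∀ {a} → a ≢ 0F → ∀ b → a ⁻¹ ⊗ (a ⊗ b) ≡ b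
  ⁻¹-cancelʳ {a} a≢0 b = trans (sym (⊗-assoc (a ⁻¹) a b))
    (trans (cong (_⊗ b) (trans (⊗-comm _ a) (⁻¹-inverseʳ a≢0))) (⊗-identityˡ b))

  ⊗-≢0 : ∀ {a b} → a ≢ 0F → b ≢ 0F → a ⊗ b ≢ 0F
  ⊗-≢0 {a} {b} a≢0 b≢0 ab≡0 =
    b≢0 (trans (sym (⁻¹-cancelʳ a≢0 b)) (trans (cong (a ⁻¹ ⊗_) ab≡0) (⊗-zeroʳ _)))

  ⁻¹-≢0 : ∀ {a} → a ≢ 0F → a ⁻¹ ≢ 0F
  ⁻¹-≢0 {a} a≢0 h = 1≢0 (trans (sym (⁻¹-inverseʳ a≢0)) (trans (cong (a ⊗_) h) (⊗-zeroʳ a)))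

  ∑-translate : (f : F → ℕ) (b : F) → ∑ elemsF (λ a → f (b ⊕ a)) ≡ ∑ elemsF f
  ∑-translate f b = Enumeration.∑-bijection 𝔽 f (b ⊕_) (⊖ b ⊕_)
    (λ x → trans (sym (⊕-assoc b (⊖ b) x)) (trans (cong (_⊕ x) (⊖-inverseʳ b)) (⊕-identityˡ x)))
    (λ x → trans (sym (⊕-assoc (⊖ b) b x)) (trans (cong (_⊕ x) (⊖-inverseˡ b)) (⊕-identityˡ x)))

  ∑-dilate : (f : F → ℕ) {b : F} → b ≢ 0F → ∑ elemsF (λ a → f (b ⊗ a)) ≡ ∑ elemsF f
  ∑-dilate f {b} b≢0 = Enumeration.∑-bijection 𝔽 f (b ⊗_) (b ⁻¹ ⊗_) (⁻¹-cancelˡ b≢0) (⁻¹-cancelʳ b≢0)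

  ∑𝔽-const : ∀ c → ∑ elemsF (λ _ → c) ≡ q * c
  ∑𝔽-const c = trans (∑-const elemsF c) (cong (_* c) length-elems𝔽)

  ∑𝕍-const : ∀ k c → ∑ (elemsV k) (λ _ → c) ≡ q ^ k * c
  ∑𝕍-const zero    c = trans (∑𝕍-zero (λ _ → c)) (sym (*-identityˡ c))
  ∑𝕍-const (suc k) c = begin
    ∑ (elemsV (suc k)) (λ _ → c)                 ≡⟨ ∑𝕍-suc k _ ⟩
    ∑ elemsF (λ _ → ∑ (elemsV k) (λ _ → c))      ≡⟨ ∑-cong elemsF (λ _ → ∑𝕍-const k c) ⟩
    ∑ elemsF (λ _ → q ^ k * c)                   ≡⟨ ∑𝔽-const _ ⟩
    q * (q ^ k * c)                              ≡⟨ *-assoc q (q ^ k) c ⟨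
    q ^ suc k * c                                ∎
    where open ≡-Reasoning

  nz : F → ℕ
  nz a = ⟦ ¬? (a ≟ 0F) ⟧

  nz-0 : nz 0F ≡ 0
  nz-0 = ⟦⟧-no (¬? (0F ≟ 0F)) (λ h → h refl)

  nz-≢0 : ∀ {a} → a ≢ 0F → nz a ≡ 1
  nz-≢0 {a} h = ⟦⟧-yes (¬? (a ≟ 0F)) h

  ∑-nz : ∑ elemsF nz ≡ suc ρ
  ∑-nz = suc-injective (begin
    1 + ∑ elemsF nz                                        ≡⟨ +-comm 1 _ ⟩
    ∑ elemsF nz + 1                                        ≡⟨ cong (∑ elemsF nz +_) (Enumeration.once 𝔽 0F) ⟨
    ∑ elemsF nz + ∑ elemsF (λ a → ⟦ a ≟ 0F ⟧)              ≡⟨ ∑-+ elemsF nz _ ⟨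
    ∑ elemsF (λ a → nz a + ⟦ a ≟ 0F ⟧)                     ≡⟨ ∑-cong elemsF (λ a → ⟦¬⟧ (a ≟ 0F)) ⟩
    ∑ elemsF (λ _ → 1)                                     ≡⟨ ∑𝔽-const 1 ⟩
    q * 1                                                  ≡⟨ *-identityʳ q ⟩
    q                                                      ≡⟨ q≡2+ρ ⟩
    2 + ρ                                                  ∎)
    where open ≡-Reasoning

  ∑-nz-affine : ∀ {a} b → a ≢ 0F → ∑ elemsF (λ x → nz (x ⊗ a ⊕ b)) ≡ suc ρ
  ∑-nz-affine {a} b a≢0 = begin
    ∑ elemsF (λ x → nz (x ⊗ a ⊕ b))  ≡⟨ ∑-cong elemsF (λ x → cong nz (trans (⊕-comm _ b) (cong (b ⊕_) (⊗-comm x a)))) ⟩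
    ∑ elemsF (λ x → nz (b ⊕ a ⊗ x))  ≡⟨ ∑-dilate (λ y → nz (b ⊕ y)) a≢0 ⟩
    ∑ elemsF (λ y → nz (b ⊕ y))      ≡⟨ ∑-translate nz b ⟩
    ∑ elemsF nz                      ≡⟨ ∑-nz ⟩
    suc ρ                            ∎
    where open ≡-Reasoning

  0ⱽ : ∀ {k} → V k
  0ⱽ {zero}  = []
  0ⱽ {suc k} = 0F ∷ 0ⱽ

  infixl 6 _+ⱽ_
  infixr 7 _·ⱽ_
  _+ⱽ_ : ∀ {k} → V k → V k → V k
  []      +ⱽ []      = []
  (a ∷ x) +ⱽ (b ∷ y) = a ⊕ b ∷ x +ⱽ y

  _·ⱽ_ : ∀ {k} → F → V k → V k
  a ·ⱽ []      = []
  a ·ⱽ (b ∷ x) = a ⊗ b ∷ a ·ⱽ x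

  infix 8 _∙_
  _∙_ : ∀ {k} → V k → V k → F
  []      ∙ []      = 0F
  (a ∷ x) ∙ (b ∷ y) = a ⊗ b ⊕ x ∙ y

  ∙-comm : ∀ {k} (x y : V k) → x ∙ y ≡ y ∙ x
  ∙-comm []      []      = refl
  ∙-comm (a ∷ x) (b ∷ y) = cong₂ _⊕_ (⊗-comm a b) (∙-comm x y)

  ∙-+ˡ : ∀ {k} (x x' y : V k) → (x +ⱽ x') ∙ y ≡ x ∙ y ⊕ x' ∙ y
  ∙-+ˡ []      []        []      = sym (⊕-identityˡ 0F)
  ∙-+ˡ (a ∷ x) (a' ∷ x') (b ∷ y) = trans (cong ((a ⊕ a') ⊗ b ⊕_) (∙-+ˡ x x' y))
    (solveF 5 (λ a a' b s t → (a :+ a') :* b :+ (s :+ t) := (a :* b :+ s) :+ (a' :* b :+ t)) refl a a' b (x ∙ y) (x' ∙ y))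

  ∙-·ˡ : ∀ {k} a (x y : V k) → (a ·ⱽ x) ∙ y ≡ a ⊗ x ∙ y
  ∙-·ˡ a []      []      = sym (⊗-zeroʳ a)
  ∙-·ˡ a (b ∷ x) (c ∷ y) = trans (cong ((a ⊗ b) ⊗ c ⊕_) (∙-·ˡ a x y))
    (solveF 4 (λ a b c s → (a :* b) :* c :+ a :* s := a :* (b :* c :+ s)) refl a b c (x ∙ y))

  ∙-+ʳ : ∀ {k} (y x x' : V k) → y ∙ (x +ⱽ x') ≡ y ∙ x ⊕ y ∙ x'
  ∙-+ʳ y x x' = trans (∙-comm y _) (trans (∙-+ˡ x x' y) (cong₂ _⊕_ (∙-comm x y) (∙-comm x' y)))

  ∙-·ʳ : ∀ {k} a (y x : V k) → y ∙ (a ·ⱽ x) ≡ a ⊗ y ∙ x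
  ∙-·ʳ a y x = trans (∙-comm y _) (trans (∙-·ˡ a x y) (cong (a ⊗_) (∙-comm x y)))

  ∙-0ˡ : ∀ {k} (y : V k) → 0ⱽ ∙ y ≡ 0F
  ∙-0ˡ []      = refl
  ∙-0ˡ (b ∷ y) = trans (cong₂ _⊕_ (⊗-zeroˡ b) (∙-0ˡ y)) (⊕-identityˡ 0F)

  ∙-0ʳ : ∀ {k} (y : V k) → y ∙ 0ⱽ ≡ 0F
  ∙-0ʳ y = trans (∙-comm y 0ⱽ) (∙-0ˡ y)

  0∷-∙ : ∀ {k} (x : V k) (c : V (suc k)) → (0F ∷ x) ∙ c ≡ x ∙ Vec.tail c
  0∷-∙ x (h ∷ t) = trans (cong (_⊕ x ∙ t) (⊗-zeroˡ h)) (⊕-identityˡ _)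

  1∷0-∙ : ∀ {k} (c : V (suc k)) → (1F ∷ 0ⱽ) ∙ c ≡ Vec.head c
  1∷0-∙ (h ∷ t) = trans (cong₂ _⊕_ (⊗-identityˡ h) (∙-0ˡ t)) (⊕-identityʳ h)

  -- Reduces equations between vectors to bilinearity, by pairing both sides with an arbitrary
  -- vector.
  nondegenerate : ∀ {k} (x x' : V k) → (∀ y → x ∙ y ≡ x' ∙ y) → x ≡ x'
  nondegenerate []      []        h = refl
  nondegenerate (a ∷ x) (a' ∷ x') h = cong₂ _∷_
    (trans (sym (at-head a x)) (trans (h (1F ∷ 0ⱽ)) (at-head a' x')))
    (nondegenerate x x' λ y → trans (sym (at-tail a x y)) (trans (h (0F ∷ y)) (at-tail a' x' y)))
    where
    at-head : ∀ {k} a (x : V k) → (a ∷ x) ∙ (1F ∷ 0ⱽ) ≡ a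
    at-head a x = trans (∙-comm (a ∷ x) (1F ∷ 0ⱽ)) (1∷0-∙ (a ∷ x))
    at-tail : ∀ {k} a (x y : V k) → (a ∷ x) ∙ (0F ∷ y) ≡ x ∙ y
    at-tail a x y = trans (∙-comm (a ∷ x) (0F ∷ y)) (trans (0∷-∙ y (a ∷ x)) (∙-comm y x))

  nondegenerateʳ : ∀ {k} (x x' : V k) → (∀ y → y ∙ x ≡ y ∙ x') → x ≡ x'
  nondegenerateʳ x x' h = nondegenerate x x' (λ y → trans (∙-comm x y) (trans (h y) (∙-comm y x')))

  ∃-∙≡1 : ∀ {k} (x : V k) → x ≢ 0ⱽ → ∃ λ w → w ∙ x ≡ 1F
  ∃-∙≡1 []      x≢0 = contradiction refl x≢0
  ∃-∙≡1 (a ∷ x) x≢0 with a ≟ 0F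
  ... | no a≢0 = a ⁻¹ ∷ 0ⱽ , trans (cong₂ _⊕_ (trans (⊗-comm _ a) (⁻¹-inverseʳ a≢0)) (∙-0ˡ x)) (⊕-identityʳ 1F)
  ... | yes refl with ∃-∙≡1 x (λ h → x≢0 (cong (0F ∷_) h))
  ...   | w , wx≡1 = 0F ∷ w , trans (0∷-∙ w (0F ∷ x)) wx≡1

  -- Written as a product so that the commutative semiring solver can treat `⊖ 1F` as an atom.
  neg : F → F
  neg a = ⊖ 1F ⊗ a

  ⊕-neg : ∀ a → a ⊕ neg a ≡ 0F
  ⊕-neg a = trans (cong (_⊕ neg a) (sym (⊗-identityˡ a)))
    (trans (sym (⊗-distribʳ-⊕ a 1F (⊖ 1F))) (trans (cong (_⊗ a) (⊖-inverseʳ 1F)) (⊗-zeroˡ a)))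

  ⊕-neg-cancel : ∀ a b → a ⊕ b ⊕ neg b ≡ a
  ⊕-neg-cancel a b = trans (⊕-assoc a b (neg b)) (trans (cong (a ⊕_) (⊕-neg b)) (⊕-identityʳ a))

  neg-⊕-cancel : ∀ a b → a ⊕ neg b ⊕ b ≡ a
  neg-⊕-cancel a b = trans (⊕-assoc a (neg b) b)
    (trans (cong (a ⊕_) (trans (⊕-comm (neg b) b) (⊕-neg b))) (⊕-identityʳ a))

  -- A change of basis: τ acts on columns and μ is its adjoint on messages; σ = τ⁻¹, ν = μ⁻¹.
  record Basis (k : ℕ) : Set where
    field
      τ σ μ ν : V k → V k
      τσ   : ∀ c → τ (σ c) ≡ c
      στ   : ∀ c → σ (τ c) ≡ c
      adjτ : ∀ y c → y ∙ τ c ≡ μ y ∙ c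
      adjσ : ∀ y c → y ∙ σ c ≡ ν y ∙ c

    ν∙τ : ∀ y c → ν y ∙ τ c ≡ y ∙ c
    ν∙τ y c = trans (sym (adjσ y (τ c))) (cong (y ∙_) (στ c))

    μν : ∀ y → μ (ν y) ≡ y
    μν y = nondegenerate _ _ (λ c → trans (sym (adjτ (ν y) c)) (ν∙τ y c))

    μ≢0 : ∀ {y} → y ≢ 0ⱽ → μ y ≢ 0ⱽ
    μ≢0 {y} y≢0 μy≡0 = y≢0 (nondegenerate y 0ⱽ λ c → begin
      y ∙ c            ≡⟨ cong (y ∙_) (τσ c) ⟨
      y ∙ τ (σ c)      ≡⟨ adjτ y (σ c) ⟩
      μ y ∙ σ c        ≡⟨ cong (_∙ σ c) μy≡0 ⟩
      0ⱽ ∙ σ c         ≡⟨ ∙-0ˡ (σ c) ⟩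
      0F               ≡⟨ ∙-0ˡ c ⟨
      0ⱽ ∙ c           ∎)
      where open ≡-Reasoning

    -- A map with an adjoint for a nondegenerate form is linear, which is why linearity is not a
    -- field of `Basis`.
    τ-· : ∀ a c → τ (a ·ⱽ c) ≡ a ·ⱽ τ c
    τ-· a c = nondegenerateʳ _ _ λ y → begin
      y ∙ τ (a ·ⱽ c)   ≡⟨ adjτ y _ ⟩
      μ y ∙ (a ·ⱽ c)   ≡⟨ ∙-·ʳ a (μ y) c ⟩
      a ⊗ μ y ∙ c      ≡⟨ cong (a ⊗_) (adjτ y c) ⟨
      a ⊗ y ∙ τ c      ≡⟨ ∙-·ʳ a y (τ c) ⟨
      y ∙ (a ·ⱽ τ c)   ∎
      where open ≡-Reasoning

    μ-· : ∀ a y → μ (a ·ⱽ y) ≡ a ·ⱽ μ y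
    μ-· a y = nondegenerate _ _ λ c → begin
      μ (a ·ⱽ y) ∙ c   ≡⟨ adjτ _ c ⟨
      (a ·ⱽ y) ∙ τ c   ≡⟨ ∙-·ˡ a y (τ c) ⟩
      a ⊗ y ∙ τ c      ≡⟨ cong (a ⊗_) (adjτ y c) ⟩
      a ⊗ μ y ∙ c      ≡⟨ ∙-·ˡ a (μ y) c ⟨
      (a ·ⱽ μ y) ∙ c   ∎
      where open ≡-Reasoning

    ∑-τ : (f : V k → ℕ) → ∑ (elemsV k) (f ∘ τ) ≡ ∑ (elemsV k) f
    ∑-τ f = Enumeration.∑-bijection (𝕍 k) f τ σ τσ στ

  identity : ∀ k → Basis k
  identity k = record { τ = id ; σ = id ; μ = id ; ν = id ; τσ = λ _ → refl ; στ = λ _ → refl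
                      ; adjτ = λ _ _ → refl ; adjσ = λ _ _ → refl }

  infixr 9 _∘ᴮ_
  _∘ᴮ_ : ∀ {k} → Basis k → Basis k → Basis k
  B ∘ᴮ A = record
    { τ = B.τ ∘ A.τ ; σ = A.σ ∘ B.σ ; μ = A.μ ∘ B.μ ; ν = B.ν ∘ A.ν
    ; τσ = λ c → trans (cong B.τ (A.τσ (B.σ c))) (B.τσ c)
    ; στ = λ c → trans (cong A.σ (B.στ (A.τ c))) (A.στ c)
    ; adjτ = λ y c → trans (B.adjτ y (A.τ c)) (A.adjτ (B.μ y) c)
    ; adjσ = λ y c → trans (A.adjσ y (B.σ c)) (B.adjσ (A.ν y) c)
    }
    where
    module A = Basis A
    module B = Basis B

  onTail : ∀ {k} → (V k → V k) → V (suc k) → V (suc k)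
  onTail f (h ∷ t) = h ∷ f t

  extend : ∀ {k} → Basis k → Basis (suc k)
  extend B = record
    { τ = onTail τ ; σ = onTail σ ; μ = onTail μ ; ν = onTail ν
    ; τσ = λ { (h ∷ t) → cong (h ∷_) (τσ t) } ; στ = λ { (h ∷ t) → cong (h ∷_) (στ t) }
    ; adjτ = λ { (a ∷ x) (h ∷ t) → cong (a ⊗ h ⊕_) (adjτ x t) }
    ; adjσ = λ { (a ∷ x) (h ∷ t) → cong (a ⊗ h ⊕_) (adjσ x t) }
    }
    where open Basis B

  transposition : ∀ k → Basis (2 + k)
  transposition k = record
    { τ = swap ; σ = swap ; μ = swap ; ν = swap ; τσ = involutive ; στ = involutive ; adjτ = adj ; adjσ = adj }
    where
    swap : V (2 + k) → V (2 + k)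
    swap (a ∷ b ∷ x) = b ∷ a ∷ x
    involutive : ∀ x → swap (swap x) ≡ x
    involutive (a ∷ b ∷ x) = refl
    adj : ∀ y c → y ∙ swap c ≡ swap y ∙ c
    adj (a ∷ b ∷ x) (g ∷ h ∷ t) =
      solveF 5 (λ a b g h s → a :* h :+ (b :* g :+ s) := b :* g :+ (a :* h :+ s)) refl a b g h (x ∙ t)

  -- The matrix with first row `a ∷ c` and the identity below; `μ` and `ν` are the transposes of it
  -- and of its inverse.
  shear : ∀ {k} (a : F) (c : V k) → a ≢ 0F → Basis (suc k)
  shear {k} a c a≢0 = record
    { τ = τ ; σ = σ ; μ = μ ; ν = ν
    ; τσ = λ { (h ∷ t) → cong (_∷ t) (trans (cong (_⊕ c ∙ t) (⁻¹-cancelˡ a≢0 _)) (neg-⊕-cancel h (c ∙ t))) }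
    ; στ = λ { (h ∷ t) → cong (_∷ t) (trans (cong (a ⁻¹ ⊗_) (⊕-neg-cancel (a ⊗ h) (c ∙ t))) (⁻¹-cancelʳ a≢0 h)) }
    ; adjτ = λ { (b ∷ x) (h ∷ t) → trans
        (solveF 5 (λ a b h s r → b :* (a :* h :+ s) :+ r := b :* a :* h :+ (b :* s :+ r)) refl a b h (c ∙ t) (x ∙ t))
        (cong (b ⊗ a ⊗ h ⊕_) (sym (combine b x t))) }
    ; adjσ = λ { (b ∷ x) (h ∷ t) → trans
        (solveF 6 (λ a b h m s r → b :* (a :* (h :+ m :* s)) :+ r := b :* a :* h :+ (b :* a :* m :* s :+ r)) refl
          (a ⁻¹) b h (⊖ 1F) (c ∙ t) (x ∙ t))
        (cong (b ⊗ a ⁻¹ ⊗ h ⊕_) (sym (combine (b ⊗ a ⁻¹ ⊗ ⊖ 1F) x t))) }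
    }
    where
    τ σ μ ν : V (suc k) → V (suc k)
    τ (h ∷ t) = a ⊗ h ⊕ c ∙ t ∷ t
    σ (h ∷ t) = a ⁻¹ ⊗ (h ⊕ neg (c ∙ t)) ∷ t
    μ (b ∷ x) = b ⊗ a ∷ b ·ⱽ c +ⱽ x
    ν (b ∷ x) = b ⊗ a ⁻¹ ∷ (b ⊗ a ⁻¹ ⊗ ⊖ 1F) ·ⱽ c +ⱽ x
    combine : ∀ b x t → (b ·ⱽ c +ⱽ x) ∙ t ≡ b ⊗ c ∙ t ⊕ x ∙ t
    combine b x t = trans (∙-+ˡ (b ·ⱽ c) x t) (cong (_⊕ x ∙ t) (∙-·ˡ b c t))

  -- Coordinates in which the message `c` is the first unit vector, so that its codeword is read off
  -- the heads of the columns.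
  record Pivot {k} (c : V (suc k)) : Set where
    field
      basis  : Basis (suc k)
      head-τ : ∀ v → head (Basis.τ basis v) ≡ c ∙ v
    open Basis basis public

    ν-pivot : ν c ≡ 1F ∷ 0ⱽ
    ν-pivot = nondegenerate _ _ λ v → begin
      ν c ∙ v             ≡⟨ adjσ c v ⟨
      c ∙ σ v             ≡⟨ head-τ (σ v) ⟨
      head (τ (σ v))      ≡⟨ cong head (τσ v) ⟩
      head v              ≡⟨ 1∷0-∙ v ⟨
      (1F ∷ 0ⱽ) ∙ v       ∎
      where open ≡-Reasoning

  opaque
    -- Gaussian elimination: a nonzero head allows a shear; otherwise the tail is pivoted and its
    -- new first coordinate is swapped to the front.
    pivot : ∀ {k} (c : V (suc k)) → c ≢ 0ⱽ → Pivot c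
    pivot (a ∷ c) c≢0 with a ≟ 0F
    pivot (a ∷ c) c≢0 | no a≢0 = record { basis = shear a c a≢0 ; head-τ = λ { (h ∷ t) → refl } }
    pivot {zero}  (a ∷ []) c≢0 | yes refl = contradiction refl c≢0
    pivot {suc k} (a ∷ c)  c≢0 | yes refl = record
      { basis = transposition k ∘ᴮ extend basis
      ; head-τ = λ { (h ∷ t) → trans (head-swap h (τ t)) (trans (head-τ t) (sym (0∷-∙ c (h ∷ t)))) }
      }
      where
      open Pivot (pivot c (λ h → c≢0 (cong (0F ∷_) h)))
      head-swap : ∀ h (t : V (suc k)) → head (Basis.τ (transposition k) (h ∷ t)) ≡ head t
      head-swap h (g ∷ t) = refl

  -- Codes and residual codes

  Cols : ℕ → Set
  Cols k = List (V k)

  weight : ∀ {k} → Cols k → V k → ℕ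
  weight L x = ∑ L (λ c → nz (x ∙ c))

  weight-0 : ∀ {k} (L : Cols k) → weight L 0ⱽ ≡ 0
  weight-0 L = ∑-zero L (λ c → trans (cong nz (∙-0ˡ c)) nz-0)

  module _ {k} (B : Basis k) where
    open Basis B

    weight-τ : ∀ L x → weight (map τ L) x ≡ weight L (μ x)
    weight-τ L x = trans (∑-map τ L _) (∑-cong L (λ c → cong nz (adjτ x c)))

    weight-ν : ∀ L x → weight (map τ L) (ν x) ≡ weight L x
    weight-ν L x = trans (weight-τ L (ν x)) (cong (weight L) (μν x))

  headWt : ∀ {k} → Cols (suc k) → ℕ
  headWt L = ∑ L (λ c → nz (head c))

  headWt-pivot : ∀ {k} {c : V (suc k)} (P : Pivot c) L → headWt (map (Pivot.τ P) L) ≡ weight L c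
  headWt-pivot P L = trans (∑-map (Pivot.τ P) L _) (∑-cong L (λ v → cong nz (Pivot.head-τ P v)))

  -- The residual code with respect to the first row.
  res : ∀ {k} → Cols (suc k) → Cols k
  res [] = []
  res ((h ∷ t) ∷ L) with h ≟ 0F
  ... | yes _ = t ∷ res L
  ... | no _  = res L

  ∑-res : ∀ {k} (L : Cols (suc k)) (f : V k → ℕ) → ∑ (res L) f ≡ ∑ L (λ c → ⟦ head c ≟ 0F ⟧ * f (tail c))
  ∑-res []            f = refl
  ∑-res ((h ∷ t) ∷ L) f with h ≟ 0F
  ... | yes _ = cong₂ _+_ (sym (+-identityʳ (f t))) (∑-res L f)
  ... | no _  = ∑-res L f

  length-res : ∀ {k} (L : Cols (suc k)) → headWt L + length (res L) ≡ length L
  length-res []            = refl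
  length-res ((h ∷ t) ∷ L) with h ≟ 0F
  ... | yes _ = trans (+-suc (headWt L) _) (cong suc (length-res L))
  ... | no _  = cong suc (length-res L)

  -- Count column by column. If the head is nonzero, the entry is an affine bijection of `a`,
  -- nonzero q - 1 times, and the head itself supplies the missing 1. If the head is zero, the entry
  -- does not depend on `a`.
  ∑-line-head : ∀ {k} (L : Cols (suc k)) x →
                ∑ elemsF (λ a → weight L (a ∷ x)) + headWt L ≡ q * (headWt L + weight (res L) x)
  ∑-line-head L x = begin
    ∑ elemsF (λ a → weight L (a ∷ x)) + headWt L
      ≡⟨ cong (_+ headWt L) (∑-comm elemsF L _) ⟩
    ∑ L (λ c → ∑ elemsF (λ a → nz ((a ∷ x) ∙ c))) + headWt L
      ≡⟨ ∑-+ L _ _ ⟨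
    ∑ L (λ c → ∑ elemsF (λ a → nz ((a ∷ x) ∙ c)) + nz (head c))
      ≡⟨ ∑-cong L column ⟩
    ∑ L (λ c → q * (nz (head c) + ⟦ head c ≟ 0F ⟧ * nz (x ∙ tail c)))
      ≡⟨ ∑-* L q _ ⟩
    q * ∑ L (λ c → nz (head c) + ⟦ head c ≟ 0F ⟧ * nz (x ∙ tail c))
      ≡⟨ cong (q *_) (trans (∑-+ L _ _) (cong (headWt L +_) (sym (∑-res L _)))) ⟩
    q * (headWt L + weight (res L) x) ∎
    where
    open ≡-Reasoning
    column : ∀ c → ∑ elemsF (λ a → nz ((a ∷ x) ∙ c)) + nz (head c) ≡
                   q * (nz (head c) + ⟦ head c ≟ 0F ⟧ * nz (x ∙ tail c))
    column (h ∷ t) with h ≟ 0F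
    ... | yes refl = begin
      ∑ elemsF (λ a → nz (a ⊗ 0F ⊕ x ∙ t)) + 0
        ≡⟨ +-identityʳ _ ⟩
      ∑ elemsF (λ a → nz (a ⊗ 0F ⊕ x ∙ t))
        ≡⟨ ∑-cong elemsF (λ a → cong nz (trans (cong (_⊕ x ∙ t) (⊗-zeroʳ a)) (⊕-identityˡ _))) ⟩
      ∑ elemsF (λ a → nz (x ∙ t))
        ≡⟨ ∑𝔽-const _ ⟩
      q * nz (x ∙ t)
        ≡⟨ cong (q *_) (+-identityʳ (nz (x ∙ t))) ⟨
      q * (nz (x ∙ t) + 0) ∎
    ... | no h≢0 = begin
      ∑ elemsF (λ a → nz (a ⊗ h ⊕ x ∙ t)) + 1  ≡⟨ cong (_+ 1) (∑-nz-affine (x ∙ t) h≢0) ⟩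
      suc ρ + 1                                ≡⟨ +-comm (suc ρ) 1 ⟩
      2 + ρ                                    ≡⟨ q≡2+ρ ⟨
      q                                        ≡⟨ *-identityʳ q ⟨
      q * 1                                    ∎

  -- In pivot coordinates for `v`, adding `a ·ⱽ v` changes only the first coordinate of the message.
  weight-line : ∀ {k} {v : V (suc k)} (P : Pivot v) L u a →
            weight L (u +ⱽ a ·ⱽ v) ≡ weight (map (Pivot.τ P) L) (head (Pivot.ν P u) ⊕ a ∷ tail (Pivot.ν P u))
  weight-line {v = v} P L u a = trans (∑-cong L (λ c → cong nz (column c))) (sym (∑-map τ L _))
    where
    open Pivot P
    open ≡-Reasoning
    spread : ∀ y c → (head y ⊕ a ∷ tail y) ∙ c ≡ y ∙ c ⊕ a ⊗ head c
    spread (b ∷ x) (h ∷ t) =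
      solveF 4 (λ a b h s → (b :+ a) :* h :+ s := b :* h :+ s :+ a :* h) refl a b h (x ∙ t)
    column : ∀ c → (u +ⱽ a ·ⱽ v) ∙ c ≡ (head (ν u) ⊕ a ∷ tail (ν u)) ∙ τ c
    column c = begin
      (u +ⱽ a ·ⱽ v) ∙ c                       ≡⟨ ∙-+ˡ u (a ·ⱽ v) c ⟩
      u ∙ c ⊕ (a ·ⱽ v) ∙ c                    ≡⟨ cong₂ _⊕_ (sym (ν∙τ u c)) (trans (∙-·ˡ a v c) (cong (a ⊗_) (sym (head-τ c)))) ⟩
      ν u ∙ τ c ⊕ a ⊗ head (τ c)              ≡⟨ spread (ν u) (τ c) ⟨
      (head (ν u) ⊕ a ∷ tail (ν u)) ∙ τ c     ∎

  ∑-line : ∀ {k} {v : V (suc k)} (P : Pivot v) L u →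
           ∑ elemsF (λ a → weight L (u +ⱽ a ·ⱽ v)) + weight L v ≡
           q * (weight L v + weight (res (map (Pivot.τ P) L)) (tail (Pivot.ν P u)))
  ∑-line {v = v} P L u = begin
    ∑ elemsF (λ a → weight L (u +ⱽ a ·ⱽ v)) + weight L v
      ≡⟨ cong₂ _+_ (∑-cong elemsF (weight-line P L u)) (sym head≡) ⟩
    ∑ elemsF (λ a → weight L' (head (ν u) ⊕ a ∷ tail (ν u))) + headWt L'
      ≡⟨ cong (_+ headWt L') (∑-translate (λ a → weight L' (a ∷ tail (ν u))) (head (ν u))) ⟩
    ∑ elemsF (λ a → weight L' (a ∷ tail (ν u))) + headWt L'
      ≡⟨ ∑-line-head L' (tail (ν u)) ⟩
    q * (headWt L' + weight (res L') (tail (ν u)))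
      ≡⟨ cong (λ x → q * (x + weight (res L') (tail (ν u)))) head≡ ⟩
    q * (weight L v + weight (res L') (tail (ν u))) ∎
    where
    open ≡-Reasoning
    open Pivot P
    L' = map τ L
    head≡ : headWt L' ≡ weight L v
    head≡ = headWt-pivot P L

  MinWt : ∀ {k} → ℕ → Cols k → Set
  MinWt d L = ∀ x → x ≢ 0ⱽ → d ≤ weight L x

  MinWt-τ : ∀ {k d} (B : Basis k) L → MinWt d L → MinWt d (map (Basis.τ B) L)
  MinWt-τ B L h x x≢0 = subst (_ ≤_) (sym (weight-τ B L x)) (h (Basis.μ B x) (Basis.μ≢0 B x≢0))

  -- All q words `a ∷ x` have weight at least `d`, so the line identity gives d ≤ q w for the
  -- residual weight w.
  MinWt-res : ∀ {k d} (L : Cols (suc k)) → MinWt d L → headWt L ≡ d → MinWt ⌈ d / q ⌉ (res L)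
  MinWt-res {d = d} L h hd≡d x x≢0 = ⌈/⌉-least d q _ (+-cancelˡ-≤ (q * d) d _ (begin
    q * d + d                                   ≤⟨ +-monoˡ-≤ d line-lower ⟩
    ∑ elemsF (λ a → weight L (a ∷ x)) + d           ≡⟨ cong (∑ elemsF (λ a → weight L (a ∷ x)) +_) hd≡d ⟨
    ∑ elemsF (λ a → weight L (a ∷ x)) + headWt L    ≡⟨ ∑-line-head L x ⟩
    q * (headWt L + weight (res L) x)               ≡⟨ cong (λ y → q * (y + weight (res L) x)) hd≡d ⟩
    q * (d + weight (res L) x)                      ≡⟨ *-distribˡ-+ q d _ ⟩
    q * d + q * weight (res L) x                    ≡⟨ cong (q * d +_) (*-comm q (weight (res L) x)) ⟩
    q * d + weight (res L) x * q                    ∎))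
    where
    open ≤-Reasoning
    line-lower : q * d ≤ ∑ elemsF (λ a → weight L (a ∷ x))
    line-lower = ≤-trans (≤-reflexive (sym (∑𝔽-const d)))
      (∑-mono elemsF (λ a → h (a ∷ x) (λ e → x≢0 (cong tail e))))

  1∷0≢0 : ∀ {k} → _≢_ {A = V (suc k)} (1F ∷ 0ⱽ) 0ⱽ
  1∷0≢0 h = 1≢0 (cong head h)

  opaque
    minimum : ∀ {k} (L : Cols (suc k)) → ∃ λ c → c ≢ 0ⱽ × MinWt (weight L c) L
    minimum {k} L = descend _ (1F ∷ 0ⱽ) 1∷0≢0 ≤-refl
      where
      -- The bound `b` on the current weight makes the descent structural.
      descend : ∀ b x → x ≢ 0ⱽ → weight L x ≤ b → ∃ λ c → c ≢ 0ⱽ × MinWt (weight L c) L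
      descend b x x≢0 x≤b with Enumeration.any? (𝕍 (suc k)) (λ y → ¬? (y ≟ⱽ 0ⱽ) ×-dec (weight L y <? weight L x))
      ... | no none = x , x≢0 , λ y y≢0 → ≮⇒≥ (λ y<x → none (y , y≢0 , y<x))
      descend zero    x x≢0 x≤b | yes (y , y≢0 , y<x) = contradiction (≤-trans y<x x≤b) λ ()
      descend (suc b) x x≢0 x≤b | yes (y , y≢0 , y<x) = descend b y y≢0 (≤-pred (≤-trans y<x x≤b))

  -- The true minimum weight may exceed `d`: take the residual at a word attaining it, then use
  -- monotonicity in `d`.
  griesmer-bound : ∀ k {d} (L : Cols k) → MinWt d L → griesmer q k d ≤ length L
  griesmer-bound zero        L h = z≤n
  griesmer-bound (suc k) {d} L h with minimum L
  ... | c , c≢0 , c-min = begin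
    griesmer q (suc k) d                        ≤⟨ griesmer-mono q (suc k) (h c c≢0) ⟩
    griesmer q (suc k) (weight L c)                 ≡⟨ griesmer-rec q k (weight L c) ⟩
    weight L c + griesmer q k ⌈ weight L c / q ⌉        ≤⟨ +-monoʳ-≤ (weight L c) (griesmer-bound k (res L')
                                                     (MinWt-res L' (MinWt-τ basis L c-min) head≡)) ⟩
    weight L c + length (res L')                    ≡⟨ cong (_+ length (res L')) head≡ ⟨
    headWt L' + length (res L')                 ≡⟨ length-res L' ⟩
    length L'                                   ≡⟨ length-map _ L ⟩
    length L                                    ∎
    where
    open ≤-Reasoning
    P : Pivot c
    P = pivot c c≢0
    open Pivot P
    L' = map τ L
    head≡ : headWt L' ≡ weight L c
    head≡ = headWt-pivot P L

  -- Two inequalities suffice. Equality of the length is the Griesmer bound, and `d` is attained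
  -- because `griesmer` is strictly increasing in `d` in positive dimension.
  record Griesmer (k d : ℕ) (L : Cols k) : Set where
    field
      minWt : MinWt d L
      short : length L ≤ griesmer q k d

    exact : length L ≡ griesmer q k d
    exact = ≤-antisym short (griesmer-bound k L minWt)

  Griesmer-τ : ∀ {k d} (B : Basis k) {L} → Griesmer k d L → Griesmer k d (map (Basis.τ B) L)
  Griesmer-τ B {L} G = record
    { minWt = MinWt-τ B L (Griesmer.minWt G)
    ; short = ≤-trans (≤-reflexive (length-map (Basis.τ B) L)) (Griesmer.short G) }

  Griesmer-attained : ∀ {k d} {L : Cols (suc k)} → Griesmer (suc k) d L → ∃ λ c → c ≢ 0ⱽ × weight L c ≡ d
  Griesmer-attained {k} {d} {L} G with minimum L
  ... | c , c≢0 , c-min = c , c≢0 , ≤-antisym (≮⇒≥ not-above) (Griesmer.minWt G c c≢0)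
    where
    not-above : ¬ d < weight L c
    not-above d<weight = <⇒≱ (griesmer-strict q k d<weight)
      (≤-trans (griesmer-bound (suc k) L c-min) (Griesmer.short G))

  Griesmer-res : ∀ {k d} {L : Cols (suc k)} → Griesmer (suc k) d L → headWt L ≡ d →
                 Griesmer k ⌈ d / q ⌉ (res L)
  Griesmer-res {k} {d} {L} G hd≡d = record
    { minWt = MinWt-res L (Griesmer.minWt G) hd≡d
    ; short = +-cancelˡ-≤ d _ _ (begin
        d + length (res L)              ≡⟨ cong (_+ length (res L)) hd≡d ⟨
        headWt L + length (res L)       ≡⟨ length-res L ⟩
        length L                        ≤⟨ Griesmer.short G ⟩
        griesmer q (suc k) d            ≡⟨ griesmer-rec q k d ⟩
        d + griesmer q k ⌈ d / q ⌉      ∎)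
    }
    where open ≤-Reasoning

  ∑-nz-∙ : ∀ {k} (y : V (suc k)) → y ≢ 0ⱽ → ∑ (elemsV (suc k)) (λ v → nz (y ∙ v)) ≡ suc ρ * q ^ k
  ∑-nz-∙ {k} y y≢0 = begin
    ∑ (elemsV (suc k)) (λ v → nz (y ∙ v))         ≡⟨ ∑-cong (elemsV (suc k)) (λ v → cong nz (sym (head-τ v))) ⟩
    ∑ (elemsV (suc k)) (λ v → nz (head (τ v)))    ≡⟨ ∑-τ (λ v → nz (head v)) ⟩
    ∑ (elemsV (suc k)) (λ v → nz (head v))        ≡⟨ ∑𝕍-suc k (λ v → nz (head v)) ⟩
    ∑ elemsF (λ a → ∑ (elemsV k) (λ _ → nz a))    ≡⟨ ∑-cong elemsF (λ a → ∑𝕍-const k (nz a)) ⟩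
    ∑ elemsF (λ a → q ^ k * nz a)                 ≡⟨ ∑-* elemsF (q ^ k) nz ⟩
    q ^ k * ∑ elemsF nz                           ≡⟨ cong (q ^ k *_) ∑-nz ⟩
    q ^ k * suc ρ                                 ≡⟨ *-comm (q ^ k) (suc ρ) ⟩
    suc ρ * q ^ k                                 ∎
    where
    open ≡-Reasoning
    open Pivot (pivot y y≢0)

  ∑-nz-∙-0 : ∀ k → ∑ (elemsV k) (λ v → nz (0ⱽ ∙ v)) ≡ 0
  ∑-nz-∙-0 k = ∑-zero (elemsV k) (λ v → trans (cong nz (∙-0ˡ v)) nz-0)

  ∑-nz-∙-≤ : ∀ {k} (y : V (suc k)) → ∑ (elemsV (suc k)) (λ v → nz (y ∙ v)) ≤ suc ρ * q ^ k
  ∑-nz-∙-≤ {k} y with y ≟ⱽ 0ⱽ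
  ... | no y≢0   = ≤-reflexive (∑-nz-∙ y y≢0)
  ... | yes refl = ≤-trans (≤-reflexive (∑-nz-∙-0 (suc k))) z≤n

  ∑-hyperplane : ∀ {k} {w : V (suc k)} (P : Pivot w) (f : V (suc k) → ℕ) →
                 ∑ (elemsV (suc k)) (λ v → ⟦ w ∙ v ≟ 0F ⟧ * f v) ≡ ∑ (elemsV k) (λ x → f (Pivot.σ P (0F ∷ x)))
  ∑-hyperplane {k} {w} P f = begin
    ∑ (elemsV (suc k)) (λ v → ⟦ w ∙ v ≟ 0F ⟧ * f v)
      ≡⟨ ∑-cong (elemsV (suc k)) (λ v → cong₂ (λ a c → ⟦ a ≟ 0F ⟧ * f c) (sym (head-τ v)) (sym (στ v))) ⟩
    ∑ (elemsV (suc k)) (λ v → ⟦ head (τ v) ≟ 0F ⟧ * f (σ (τ v)))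
      ≡⟨ ∑-τ (λ c → ⟦ head c ≟ 0F ⟧ * f (σ c)) ⟩
    ∑ (elemsV (suc k)) (λ c → ⟦ head c ≟ 0F ⟧ * f (σ c))
      ≡⟨ ∑𝕍-suc k (λ c → ⟦ head c ≟ 0F ⟧ * f (σ c)) ⟩
    ∑ elemsF (λ a → ∑ (elemsV k) (λ x → ⟦ a ≟ 0F ⟧ * f (σ (a ∷ x))))
      ≡⟨ ∑-cong elemsF (λ a → ∑-* (elemsV k) ⟦ a ≟ 0F ⟧ (λ x → f (σ (a ∷ x)))) ⟩
    ∑ elemsF (λ a → ⟦ a ≟ 0F ⟧ * ∑ (elemsV k) (λ x → f (σ (a ∷ x))))
      ≡⟨ Enumeration.∑-point 𝔽 (λ a → ∑ (elemsV k) (λ x → f (σ (a ∷ x)))) 0F ⟩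
    ∑ (elemsV k) (λ x → f (σ (0F ∷ x))) ∎
    where
    open ≡-Reasoning
    open Pivot P

  ∑-hyperplane-1 : ∀ {k} (w : V (suc k)) → w ≢ 0ⱽ → ∑ (elemsV (suc k)) (λ v → ⟦ w ∙ v ≟ 0F ⟧) ≡ q ^ k
  ∑-hyperplane-1 {k} w w≢0 = begin
    ∑ (elemsV (suc k)) (λ v → ⟦ w ∙ v ≟ 0F ⟧)      ≡⟨ ∑-cong (elemsV (suc k)) (λ v → *-identityʳ ⟦ w ∙ v ≟ 0F ⟧) ⟨
    ∑ (elemsV (suc k)) (λ v → ⟦ w ∙ v ≟ 0F ⟧ * 1)  ≡⟨ ∑-hyperplane (pivot w w≢0) (λ _ → 1) ⟩
    ∑ (elemsV k) (λ _ → 1)                         ≡⟨ ∑𝕍-const k 1 ⟩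
    q ^ k * 1                                      ≡⟨ *-identityʳ (q ^ k) ⟩
    q ^ k                                          ∎
    where open ≡-Reasoning

  -- Points of large multiplicity

  infix 4 _∝_ _∝?_
  -- The scalar may vanish, so zero columns count towards every point; they also disappear under
  -- `projectFrom`, as the length count for subcodes requires.
  _∝_ : ∀ {k} → V k → V k → Set
  c ∝ P = ∃ λ a → c ≡ a ·ⱽ P

  _∝?_ : ∀ {k} (c P : V k) → Dec (c ∝ P)
  c ∝? P = Enumeration.any? 𝔽 (λ a → c ≟ⱽ a ·ⱽ P)

  ∑-hyperplane-nz : ∀ {k} {w : V (2 + k)} (P : Pivot w) y →
                    ∑ (elemsV (2 + k)) (λ v → ⟦ w ∙ v ≟ 0F ⟧ * nz (y ∙ v)) ≡
                    ∑ (elemsV (1 + k)) (λ x → nz (tail (Pivot.ν P y) ∙ x))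
  ∑-hyperplane-nz {k} P y = trans (∑-hyperplane P (λ v → nz (y ∙ v)))
    (∑-cong (elemsV (1 + k)) (λ x → cong nz (trans (adjσ y (0F ∷ x)) (∙-0∷ (ν y) x))))
    where
    open Pivot P
    ∙-0∷ : ∀ {k} (y : V (suc k)) x → y ∙ (0F ∷ x) ≡ tail y ∙ x
    ∙-0∷ y x = trans (∙-comm y (0F ∷ x)) (trans (0∷-∙ x y) (∙-comm x (tail y)))

  ∑-hyperplane-nz-≤ : ∀ {k} (w y : V (2 + k)) → w ≢ 0ⱽ →
                      ∑ (elemsV (2 + k)) (λ v → ⟦ w ∙ v ≟ 0F ⟧ * nz (y ∙ v)) ≤ suc ρ * q ^ k
  ∑-hyperplane-nz-≤ w y w≢0 = ≤-trans (≤-reflexive (∑-hyperplane-nz (pivot w w≢0) y)) (∑-nz-∙-≤ (tail (Pivot.ν (pivot w w≢0) y)))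

  -- In pivot coordinates for `w`, restricting `y` to the hyperplane of `w` leaves the tail of `y`,
  -- which vanishes only for multiples of `w`.
  ∑-hyperplane-nz-≡ : ∀ {k} (w y : V (2 + k)) → w ≢ 0ⱽ → ¬ y ∝ w →
                      ∑ (elemsV (2 + k)) (λ v → ⟦ w ∙ v ≟ 0F ⟧ * nz (y ∙ v)) ≡ suc ρ * q ^ k
  ∑-hyperplane-nz-≡ {k} w y w≢0 y∝̸w = trans (∑-hyperplane-nz P y) (∑-nz-∙ (tail (ν y)) tail≢0)
    where
    P : Pivot w
    P = pivot w w≢0
    open Pivot P
    open ≡-Reasoning
    ∷0-· : ∀ {k} (z : V (suc k)) → tail z ≡ 0ⱽ → z ≡ head z ·ⱽ (1F ∷ 0ⱽ)
    ∷0-· (a ∷ z) refl = cong₂ _∷_ (sym (⊗-identityʳ a))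
      (nondegenerate _ _ λ x → trans (∙-0ˡ x) (sym (trans (∙-·ˡ a 0ⱽ x) (trans (cong (a ⊗_) (∙-0ˡ x)) (⊗-zeroʳ a)))))
    tail≢0 : tail (ν y) ≢ 0ⱽ
    tail≢0 h = y∝̸w (head (ν y) , (begin
      y                                    ≡⟨ μν y ⟨
      μ (ν y)                              ≡⟨ cong μ (∷0-· (ν y) h) ⟩
      μ (head (ν y) ·ⱽ (1F ∷ 0ⱽ))          ≡⟨ cong (λ x → μ (head (ν y) ·ⱽ x)) ν-pivot ⟨
      μ (head (ν y) ·ⱽ ν w)                ≡⟨ μ-· (head (ν y)) (ν w) ⟩
      head (ν y) ·ⱽ μ (ν w)                ≡⟨ cong (head (ν y) ·ⱽ_) (μν w) ⟩
      head (ν y) ·ⱽ w                      ∎))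

  mult : ∀ {k} → Cols k → V k → ℕ
  mult L P = ∑ L (λ c → ⟦ c ∝? P ⟧)

  mult-τ : ∀ {k} (B : Basis k) L P → mult L P ≤ mult (map (Basis.τ B) L) (Basis.τ B P)
  mult-τ B L P = ≤-trans
    (∑-mono L (λ c → ⟦⟧-mono (c ∝? P) (τ c ∝? τ P) (λ (a , c≡aP) → a , trans (cong τ c≡aP) (τ-· a P))))
    (≤-reflexive (sym (∑-map τ L (λ c → ⟦ c ∝? τ P ⟧))))
    where open Basis B

  -- The messages orthogonal to the point 1 ∷ z form the subcode with columns h ∷ t ↦ t - h z.
  projectFrom : ∀ {k} → V k → V (suc k) → V k
  projectFrom z (h ∷ t) = t +ⱽ neg h ·ⱽ z

  ∙-projectFrom : ∀ {k} (z x : V k) c → x ∙ projectFrom z c ≡ (neg (x ∙ z) ∷ x) ∙ c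
  ∙-projectFrom z x (h ∷ t) = trans (∙-+ʳ x t (neg h ·ⱽ z)) (trans (cong (x ∙ t ⊕_) (∙-·ʳ (neg h) x z))
    (solveF 4 (λ m h s r → r :+ m :* h :* s := m :* s :* h :+ r) refl (⊖ 1F) h (x ∙ z) (x ∙ t)))

  subcode : ∀ {k} → V k → Cols (suc k) → Cols k
  subcode z L = filter (λ c → ¬? (c ≟ⱽ 0ⱽ)) (map (projectFrom z) L)

  weight-subcode : ∀ {k} (z : V k) L x → weight (subcode z L) x ≡ weight L (neg (x ∙ z) ∷ x)
  weight-subcode z L x = begin
    weight (subcode z L) x
      ≡⟨ ∑-filter (λ c → ¬? (c ≟ⱽ 0ⱽ)) (map (projectFrom z) L) _ zero-col ⟩
    ∑ (map (projectFrom z) L) (λ c → nz (x ∙ c))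
      ≡⟨ ∑-map (projectFrom z) L _ ⟩
    ∑ L (λ c → nz (x ∙ projectFrom z c))
      ≡⟨ ∑-cong L (λ c → cong nz (∙-projectFrom z x c)) ⟩
    weight L (neg (x ∙ z) ∷ x) ∎
    where
    open ≡-Reasoning
    zero-col : ∀ c → ¬ c ≢ 0ⱽ → nz (x ∙ c) ≡ 0
    zero-col c ¬c≢0 with c ≟ⱽ 0ⱽ
    ... | yes refl = trans (cong nz (∙-0ʳ x)) nz-0
    ... | no c≢0   = contradiction c≢0 ¬c≢0

  length-subcode : ∀ {k} (z : V k) L → length (subcode z L) + mult L (1F ∷ z) ≤ length L
  length-subcode z L = begin
    length (subcode z L) + mult L (1F ∷ z)
      ≤⟨ +-monoʳ-≤ (length (subcode z L)) (∑-mono L (λ c → ⟦⟧-mono (c ∝? 1F ∷ z) (projectFrom z c ≟ⱽ 0ⱽ) (vanish c))) ⟩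
    length (subcode z L) + ∑ L (λ c → ⟦ projectFrom z c ≟ⱽ 0ⱽ ⟧)
      ≡⟨ cong (length (subcode z L) +_) (∑-map (projectFrom z) L (λ c → ⟦ c ≟ⱽ 0ⱽ ⟧)) ⟨
    length (subcode z L) + ∑ (map (projectFrom z) L) (λ c → ⟦ c ≟ⱽ 0ⱽ ⟧)
      ≡⟨ length-split (_≟ⱽ 0ⱽ) (map (projectFrom z) L) ⟩
    length (map (projectFrom z) L)
      ≡⟨ length-map (projectFrom z) L ⟩
    length L ∎
    where
    open ≤-Reasoning
    vanish : ∀ c → c ∝ 1F ∷ z → projectFrom z c ≡ 0ⱽ
    vanish _ (a , refl) = nondegenerateʳ _ _ λ y → trans (∙-+ʳ y (a ·ⱽ z) _)
      (trans (cong₂ _⊕_ (∙-·ʳ a y z) (∙-·ʳ (neg (a ⊗ 1F)) y z))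
      (trans (cong (λ b → a ⊗ y ∙ z ⊕ neg b ⊗ y ∙ z) (⊗-identityʳ a))
      (trans (cong (a ⊗ y ∙ z ⊕_) (⊗-assoc (⊖ 1F) a (y ∙ z)))
      (trans (⊕-neg (a ⊗ y ∙ z)) (sym (∙-0ʳ y))))))

  -- The minimum weight does not drop in a subcode, while the deleted columns pay for the last
  -- summand of `griesmer q (suc k) d`.
  subcode-Griesmer : ∀ {k d} (z : V k) L → Griesmer (suc k) d L → ⌈ d / q ^ k ⌉ ≤ mult L (1F ∷ z) →
                     Griesmer k d (subcode z L)
  subcode-Griesmer {k} {d} z L G h = record
    { minWt = λ x x≢0 → subst (d ≤_) (sym (weight-subcode z L x))
        (Griesmer.minWt G (neg (x ∙ z) ∷ x) (λ e → x≢0 (cong tail e)))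
    ; short = +-cancelʳ-≤ ⌈ d / q ^ k ⌉ _ _ (≤-trans (+-monoʳ-≤ (length (subcode z L)) h)
        (≤-trans (length-subcode z L) (Griesmer.short G)))
    }

  ∷-η : ∀ {k} (c : V (suc k)) → head c ≡ 1F → c ≡ 1F ∷ tail c
  ∷-η (_ ∷ _) refl = refl

  Good : ∀ {k} → ℕ → Cols k → V k → Set
  Good Δ L P = ∀ y → y ∙ P ≡ 0F → Δ ∣ weight L y

  Good-τ : ∀ {k Δ} (B : Basis k) L P → Good Δ (map (Basis.τ B) L) (Basis.τ B P) → Good Δ L P
  Good-τ {Δ = Δ} B L P good y yP≡0 =
    subst (Δ ∣_) (weight-ν B L y) (good (Basis.ν B y) (trans (Basis.ν∙τ B y P) yP≡0))

  Divisible : ℕ → ℕ → ℕ → Set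
  Divisible Δ k d = ∀ L → Griesmer k d L → ∀ x → Δ ∣ weight L x

  module _ {Δ k d} (IH : Divisible Δ k d) where

    good-affine : ∀ L z → Griesmer (suc k) d L → ⌈ d / q ^ k ⌉ ≤ mult L (1F ∷ z) → Good Δ L (1F ∷ z)
    good-affine L z G h (a ∷ x) a+xz≡0 =
      subst (Δ ∣_) (trans (weight-subcode z L x) (cong (λ b → weight L (b ∷ x)) (sym a≡)))
        (IH (subcode z L) (subcode-Griesmer z L G h) x)
      where
      a≡ : a ≡ neg (x ∙ z)
      a≡ = trans (sym (⊕-neg-cancel a (x ∙ z)))
        (trans (cong (_⊕ neg (x ∙ z)) (trans (cong (_⊕ x ∙ z) (sym (⊗-identityʳ a))) a+xz≡0)) (⊕-identityˡ _))

    -- Choose coordinates whose first one takes the value 1 at `P`; this reduces to the affine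
    -- chart.
    good-point : ∀ L P → P ≢ 0ⱽ → Griesmer (suc k) d L → ⌈ d / q ^ k ⌉ ≤ mult L P → Good Δ L P
    good-point L P P≢0 G h with ∃-∙≡1 P P≢0
    ... | w , wP≡1 = Good-τ basis L P (subst (Good Δ (map τ L)) (sym τP≡)
            (good-affine (map τ L) (tail (τ P)) (Griesmer-τ basis G)
              (subst (λ c → ⌈ d / q ^ k ⌉ ≤ mult (map τ L) c) τP≡ (≤-trans h (mult-τ basis L P)))))
      where
      w≢0 : w ≢ 0ⱽ
      w≢0 refl = 1≢0 (trans (sym wP≡1) (∙-0ˡ P))
      open Pivot (pivot w w≢0)
      τP≡ : τ P ≡ 1F ∷ tail (τ P)
      τP≡ = ∷-η (τ P) (trans (head-τ P) wP≡1)

  ·-++ : ∀ {r k} a (x : V r) (y : V k) → a ·ⱽ (x ++ y) ≡ (a ·ⱽ x) ++ (a ·ⱽ y)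
  ·-++ a []      y = refl
  ·-++ a (b ∷ x) y = cong (a ⊗ b ∷_) (·-++ a x y)

  ·-⁻¹ : ∀ {k a} → a ≢ 0F → (x : V k) → a ·ⱽ (a ⁻¹ ·ⱽ x) ≡ x
  ·-⁻¹ a≢0 []      = refl
  ·-⁻¹ a≢0 (b ∷ x) = cong₂ _∷_ (⁻¹-cancelˡ a≢0 b) (·-⁻¹ a≢0 x)

  take-++ : ∀ r {k} (x : V r) (y : V k) → take r (x ++ y) ≡ x
  take-++ zero    []      y = refl
  take-++ (suc r) (a ∷ x) y = cong (a ∷_) (take-++ r x y)

  ++0-∙ : ∀ r {k} (v : V r) (c : V (r + k)) → (v ++ 0ⱽ) ∙ c ≡ v ∙ take r c
  ++0-∙ zero    []      c       = ∙-0ˡ c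
  ++0-∙ (suc r) (a ∷ v) (h ∷ t) = cong (a ⊗ h ⊕_) (++0-∙ r v t)

  ++0≢0 : ∀ {r k} (v : V r) → v ≢ 0ⱽ → v ++ 0ⱽ {k} ≢ 0ⱽ
  ++0≢0 []      v≢0 h = v≢0 refl
  ++0≢0 (a ∷ v) v≢0 h with a ≟ 0F
  ... | no a≢0   = a≢0 (cong head h)
  ... | yes refl = ++0≢0 v (λ e → v≢0 (cong (0F ∷_) e)) (cong tail h)

  -- Here the scalar must be nonzero, unlike in `_∝_`: dividing by it turns the column into a
  -- multiple of some `z ++ t`.
  Aligned : ∀ r {k} → V r → V (r + k) → Set
  Aligned r z c = ∃ λ a → a ≢ 0F × take r c ≡ a ·ⱽ z

  aligned? : ∀ r {k} (z : V r) (c : V (r + k)) → Dec (Aligned r z c)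
  aligned? r z c = Enumeration.any? 𝔽 (λ a → ¬? (a ≟ 0F) ×-dec (take r c ≟ⱽ a ·ⱽ z))

  -- Pigeonhole: the aligned columns are shared among the `q ^ k` lifts `z ++ t`.
  heavy-point : ∀ r {k} (L : Cols (r + k)) z m → m * q ^ k < ∑ L (λ c → ⟦ aligned? r z c ⟧) →
                ∃ λ (t : V k) → m < mult L (z ++ t)
  heavy-point r {k} L z m h with Enumeration.any? (𝕍 k) (λ t → m <? mult L (z ++ t))
  ... | yes found = found
  ... | no none   = contradiction h (≤⇒≯ (begin
    ∑ L (λ c → ⟦ aligned? r z c ⟧)
      ≤⟨ ∑-mono L column ⟩
    ∑ L (λ c → ∑ (elemsV k) (λ t → ⟦ c ∝? z ++ t ⟧))
      ≡⟨ ∑-comm L (elemsV k) _ ⟩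
    ∑ (elemsV k) (λ t → mult L (z ++ t))
      ≤⟨ ∑-mono (elemsV k) (λ t → ≮⇒≥ (λ lt → none (t , lt))) ⟩
    ∑ (elemsV k) (λ _ → m)
      ≡⟨ ∑𝕍-const k m ⟩
    q ^ k * m
      ≡⟨ *-comm (q ^ k) m ⟩
    m * q ^ k ∎))
    where
    open ≤-Reasoning
    column : ∀ c → ⟦ aligned? r z c ⟧ ≤ ∑ (elemsV k) (λ t → ⟦ c ∝? z ++ t ⟧)
    column c with aligned? r z c
    ... | no _ = z≤n
    ... | yes (a , a≢0 , eq) = ≤-trans (≤-reflexive (sym (⟦⟧-yes (c ∝? z ++ (a ⁻¹ ·ⱽ drop r c)) (a , c≡))))
            (∑-≥∈ (λ t → ⟦ c ∝? z ++ t ⟧) (Enumeration.complete (𝕍 k) (a ⁻¹ ·ⱽ drop r c)))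
      where
      c≡ : c ≡ a ·ⱽ (z ++ (a ⁻¹ ·ⱽ drop r c))
      c≡ = trans (sym (take++drop≡id r c))
        (trans (cong₂ _++_ eq (sym (·-⁻¹ a≢0 (drop r c)))) (sym (·-++ a z _)))

  -- Supplies the pigeonhole with a strict inequality: exceeding `m` then means reaching the
  -- ceiling.
  ⌈/⌉-gap : ∀ {d} n .{{_ : NonZero n}} → 1 ≤ d → ∃ λ m → suc m ≡ ⌈ d / n ⌉ × m * n < d
  ⌈/⌉-gap {d} n 1≤d with ⌈ d / n ⌉ in eq
  ... | zero  = contradiction (≤-trans (⌈/⌉-pos n 1≤d) (≤-reflexive eq)) λ ()
  ... | suc m = m , refl , ≰⇒> λ le → <⇒≱ (n<1+n m) (≤-trans (≤-reflexive (sym eq)) (⌈/⌉-least d n m le))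

  module _ {Δ k d} (IH : Divisible Δ k d) (1≤d : 1 ≤ d) where

    -- At least `d` columns are not orthogonal to `w`. In pivot coordinates they lie over the
    -- `q ^ k` points `1F ∷ t`, one of which is therefore heavy.
    avoid : ∀ L → Griesmer (suc k) d L → ∀ w → w ≢ 0ⱽ → ∃ λ P → w ∙ P ≢ 0F × Good Δ L P
    avoid L G w w≢0 with ⌈/⌉-gap (q ^ k) {{m^n≢0 q k}} 1≤d
    ... | m , suc-m≡ , m*<d with heavy-point 1 (map τ L) (1F ∷ []) m (<-≤-trans m*<d d≤)
      where
      open Pivot (pivot w w≢0)
      open ≤-Reasoning
      head-aligned : ∀ c → nz (head c) ≤ ⟦ aligned? 1 {k} (1F ∷ []) c ⟧
      head-aligned (h ∷ t) = ⟦⟧-mono (¬? (h ≟ 0F)) (aligned? 1 (1F ∷ []) (h ∷ t))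
        (λ h≢0 → h , h≢0 , cong (_∷ []) (sym (⊗-identityʳ h)))
      d≤ : d ≤ ∑ (map τ L) (λ c → ⟦ aligned? 1 (1F ∷ []) c ⟧)
      d≤ = begin
        d                        ≤⟨ Griesmer.minWt G w w≢0 ⟩
        weight L w                   ≡⟨ headWt-pivot (pivot w w≢0) L ⟨
        headWt (map τ L)         ≤⟨ ∑-mono (map τ L) head-aligned ⟩
        _                        ∎
    ...   | t , m<mult = σ (1F ∷ t) , wP≢0 , good
      where
      open Pivot (pivot w w≢0)
      wP≢0 : w ∙ σ (1F ∷ t) ≢ 0F
      wP≢0 h = 1≢0 (trans (sym (trans (sym (head-τ (σ (1F ∷ t)))) (cong head (τσ (1F ∷ t))))) h)
      good : Good Δ L (σ (1F ∷ t))
      good = Good-τ basis L (σ (1F ∷ t)) (subst (Good Δ (map τ L)) (sym (τσ (1F ∷ t)))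
        (good-affine IH (map τ L) t (Griesmer-τ basis G) (≤-trans (≤-reflexive (sym suc-m≡)) m<mult)))

  -- Subcodes of constant weight

  nzV : ∀ {k} → V k → ℕ
  nzV c = ⟦ ¬? (c ≟ⱽ 0ⱽ) ⟧

  prefixSupport : ∀ r {k} → Cols (r + k) → ℕ
  prefixSupport r L = ∑ L (λ c → nzV (take r c))

  opaque
    -- Take a word of weight `d`, then minimum-weight words in the successive residual codes. Each
    -- adds its own weight in new columns to the support, and these weights are the summands of
    -- `griesmer q r d`.
    flag : ∀ r k {d} (L : Cols (r + k)) → Griesmer (r + k) d L →
           Σ (Basis (r + k)) λ B → prefixSupport r (map (Basis.τ B) L) ≤ griesmer q r d
    flag zero    k L G = identity k , ≤-reflexive (∑-zero (map id L) (λ { c → ⟦⟧-no (¬? ([] ≟ⱽ [])) (λ h → h refl) }))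
    flag (suc r) k {d} L G with Griesmer-attained G
    ... | c , c≢0 , wt≡d with flag r k (res (map (Pivot.τ (pivot c c≢0)) L))
                                (Griesmer-res (Griesmer-τ (Pivot.basis (pivot c c≢0)) G)
                                  (trans (headWt-pivot (pivot c c≢0) L) wt≡d))
    ...   | B' , ih = extend B' ∘ᴮ basis , (begin
      prefixSupport (suc r) (map (onTail τ' ∘ τ) L)
        ≡⟨ ∑-map (onTail τ' ∘ τ) L _ ⟩
      ∑ L (λ c → nzV (take (suc r) (onTail τ' (τ c))))
        ≡⟨ ∑-map τ L _ ⟨
      ∑ L₁ (λ c → nzV (take (suc r) (onTail τ' c)))
        ≤⟨ ∑-mono L₁ split ⟩
      ∑ L₁ (λ c → nz (head c) + ⟦ head c ≟ 0F ⟧ * nzV (take r (τ' (tail c))))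
        ≡⟨ ∑-+ L₁ _ _ ⟩
      headWt L₁ + ∑ L₁ (λ c → ⟦ head c ≟ 0F ⟧ * nzV (take r (τ' (tail c))))
        ≡⟨ cong (headWt L₁ +_) (∑-res L₁ (λ t → nzV (take r (τ' t)))) ⟨
      headWt L₁ + ∑ (res L₁) (λ t → nzV (take r (τ' t)))
        ≡⟨ cong₂ _+_ (trans (headWt-pivot (pivot c c≢0) L) wt≡d) (sym (∑-map τ' (res L₁) _)) ⟩
      d + prefixSupport r (map τ' (res L₁))
        ≤⟨ +-monoʳ-≤ d ih ⟩
      d + griesmer q r ⌈ d / q ⌉
        ≡⟨ griesmer-rec q r d ⟨
      griesmer q (suc r) d ∎)
      where
      open ≤-Reasoning
      open Pivot (pivot c c≢0)
      open Basis B' using () renaming (τ to τ')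
      L₁ : Cols (suc (r + k))
      L₁ = map τ L
      split : ∀ c → nzV (take (suc r) (onTail τ' c)) ≤ nz (head c) + ⟦ head c ≟ 0F ⟧ * nzV (take r (τ' (tail c)))
      split (h ∷ t) with h ≟ 0F
      ... | no h≢0   = ⟦⟧≤1 _
      ... | yes refl = ≤-trans
        (⟦⟧-mono (¬? (0F ∷ take r (τ' t) ≟ⱽ 0ⱽ)) (¬? (take r (τ' t) ≟ⱽ 0ⱽ)) (λ ne e → ne (cong (0F ∷_) e)))
        (≤-reflexive (sym (+-identityʳ (nzV (take r (τ' t))))))

  -- Double counting: each nonzero prefix is a linear form on the messages, nonzero at (q-1) q^r of
  -- them.
  ∑-weight-prefix : ∀ r {k} (L : Cols (suc r + k)) →
                ∑ (elemsV (suc r)) (λ v → weight L (v ++ 0ⱽ)) ≡ prefixSupport (suc r) L * (suc ρ * q ^ r)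
  ∑-weight-prefix r L = begin
    ∑ (elemsV (suc r)) (λ v → weight L (v ++ 0ⱽ))
      ≡⟨ ∑-comm (elemsV (suc r)) L _ ⟩
    ∑ L (λ c → ∑ (elemsV (suc r)) (λ v → nz ((v ++ 0ⱽ) ∙ c)))
      ≡⟨ ∑-cong L (λ c → ∑-cong (elemsV (suc r)) (λ v → cong nz (trans (++0-∙ (suc r) v c) (∙-comm v _)))) ⟩
    ∑ L (λ c → ∑ (elemsV (suc r)) (λ v → nz (take (suc r) c ∙ v)))
      ≡⟨ ∑-cong L (λ c → column (take (suc r) c)) ⟩
    ∑ L (λ c → suc ρ * q ^ r * nzV (take (suc r) c))
      ≡⟨ ∑-* L (suc ρ * q ^ r) _ ⟩
    suc ρ * q ^ r * prefixSupport (suc r) L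
      ≡⟨ *-comm (suc ρ * q ^ r) _ ⟩
    prefixSupport (suc r) L * (suc ρ * q ^ r) ∎
    where
    open ≡-Reasoning
    column : ∀ y → ∑ (elemsV (suc r)) (λ v → nz (y ∙ v)) ≡ suc ρ * q ^ r * nzV y
    column y with y ≟ⱽ 0ⱽ
    ... | yes refl = trans (∑-nz-∙-0 (suc r)) (sym (*-zeroʳ (suc ρ * q ^ r)))
    ... | no y≢0   = trans (∑-nz-∙ y y≢0) (sym (*-identityʳ (suc ρ * q ^ r)))

  -- Equality in d ≤ weight v for all v ≠ 0, by comparing the sums over v.
  constant-weight : ∀ r {k} d' (L : Cols (suc r + k)) → MinWt (q ^ r * d') L →
                    prefixSupport (suc r) L ≤ griesmer q (suc r) (q ^ r * d') →
                    ∀ v → v ≢ 0ⱽ → weight L (v ++ 0ⱽ) ≡ q ^ r * d'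
  constant-weight r {k} d' L minWt small v₀ v₀≢0 =
    ≤-antisym (≮⇒≥ not-above) (minWt (v₀ ++ 0ⱽ) (++0≢0 v₀ v₀≢0))
    where
    open ≤-Reasoning
    d g : ℕ
    d = q ^ r * d'
    g = griesmer q (suc r) d
    E : List (V (suc r))
    E = elemsV (suc r)
    -- The extra `d` stands in for the zero message, so that all `q ^ suc r` messages can be
    -- compared with weight `d`.
    total : ∑ E (λ v → weight L (v ++ 0ⱽ)) + d ≤ q ^ suc r * d
    total = begin
      ∑ E (λ v → weight L (v ++ 0ⱽ)) + d                    ≡⟨ cong (_+ d) (∑-weight-prefix r L) ⟩
      prefixSupport (suc r) L * (suc ρ * q ^ r) + d     ≤⟨ +-monoˡ-≤ d (*-monoˡ-≤ (suc ρ * q ^ r) small) ⟩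
      g * (suc ρ * q ^ r) + q ^ r * d'                  ≡⟨ factor g (suc ρ) (q ^ r) d' ⟩
      q ^ r * (suc ρ * g + d')                          ≡⟨ cong (λ x → q ^ r * (pred x * g + d')) q≡2+ρ ⟨
      q ^ r * (pred q * g + d')                         ≡⟨ cong (q ^ r *_) (griesmer-geometric q r d') ⟩
      q ^ r * (q ^ suc r * d')                          ≡⟨ swap (q ^ r) (q ^ suc r) d' ⟩
      q ^ suc r * d                                     ∎
      where
      factor : ∀ a b c e → a * (b * c) + c * e ≡ c * (b * a + e)
      factor = solve-∀
      swap : ∀ a b c → a * (b * c) ≡ b * (a * c)
      swap = solve-∀
    -- A single unit of excess at `v₀` already contradicts `total`.
    pointwise : d < weight L (v₀ ++ 0ⱽ) → ∀ v → d + ⟦ v ≟ⱽ v₀ ⟧ * 1 ≤ weight L (v ++ 0ⱽ) + ⟦ v ≟ⱽ 0ⱽ ⟧ * d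
    pointwise above v with v ≟ⱽ v₀ | v ≟ⱽ 0ⱽ
    ... | yes refl | _        = ≤-trans (≤-reflexive (+-comm d 1)) (≤-trans above (m≤m+n _ _))
    ... | no _     | yes refl = m≤n+m (d + 0) (weight L (0ⱽ {suc r} ++ 0ⱽ))
    ... | no _     | no v≢0   = +-mono-≤ (minWt (v ++ 0ⱽ) (++0≢0 v v≢0)) z≤n
    not-above : ¬ d < weight L (v₀ ++ 0ⱽ)
    not-above above = <⇒≱ (n<1+n (q ^ suc r * d)) (begin
      1 + q ^ suc r * d
        ≡⟨ +-comm 1 (q ^ suc r * d) ⟩
      q ^ suc r * d + 1
        ≡⟨ cong₂ _+_ (sym (∑𝕍-const (suc r) d)) (sym (Enumeration.∑-point (𝕍 (suc r)) (λ _ → 1) v₀)) ⟩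
      ∑ E (λ _ → d) + ∑ E (λ v → ⟦ v ≟ⱽ v₀ ⟧ * 1)
        ≡⟨ ∑-+ E _ _ ⟨
      ∑ E (λ v → d + ⟦ v ≟ⱽ v₀ ⟧ * 1)
        ≤⟨ ∑-mono E (pointwise above) ⟩
      ∑ E (λ v → weight L (v ++ 0ⱽ) + ⟦ v ≟ⱽ 0ⱽ ⟧ * d)
        ≡⟨ ∑-+ E _ _ ⟩
      ∑ E (λ v → weight L (v ++ 0ⱽ)) + ∑ E (λ v → ⟦ v ≟ⱽ 0ⱽ ⟧ * d)
        ≡⟨ cong (∑ E (λ v → weight L (v ++ 0ⱽ)) +_) (Enumeration.∑-point (𝕍 (suc r)) (λ _ → d) 0ⱽ) ⟩
      ∑ E (λ v → weight L (v ++ 0ⱽ)) + d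
        ≤⟨ total ⟩
      q ^ suc r * d ∎)

  E : List (V 3)
  E = elemsV 3

  -- In a constant-weight three-dimensional code every point carries the same number of columns:
  -- compare the weights over all of F³ with those over the plane orthogonal to z.
  module _ {k} (d' : ℕ) (L : Cols (3 + k))
           (const : ∀ (v : V 3) → v ≢ 0ⱽ → weight L (v ++ 0ⱽ) ≡ q ^ 2 * d') (z : V 3) (z≢0 : z ≢ 0ⱽ) where

    private
      d A M : ℕ
      d = q ^ 2 * d'
      A = ∑ L (λ c → ⟦ aligned? 3 z c ⟧)
      M = ∑ L (λ c → ⟦ ¬? (take 3 c ∝? z) ⟧)

      weight-0++0 : weight L (0ⱽ {3} ++ 0ⱽ) ≡ 0
      weight-0++0 = weight-0 L

    support-≤ : prefixSupport 3 L ≤ A + M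
    support-≤ = ≤-trans (∑-mono L column) (≤-reflexive (∑-+ L _ _))
      where
      column : ∀ c → nzV (take 3 c) ≤ ⟦ aligned? 3 z c ⟧ + ⟦ ¬? (take 3 c ∝? z) ⟧
      column c with take 3 c ∝? z
      ... | no _ = ≤-trans (⟦⟧≤1 (¬? (take 3 c ≟ⱽ 0ⱽ))) (m≤n+m 1 _)
      ... | yes (a , eq) = ≤-trans (⟦⟧-mono (¬? (take 3 c ≟ⱽ 0ⱽ)) (aligned? 3 z c) scalar) (m≤m+n _ 0)
        where
        scalar : take 3 c ≢ 0ⱽ → Aligned 3 z c
        scalar c≢0 = a , (λ { refl → c≢0 (trans eq (nondegenerate _ _ λ y →
          trans (∙-·ˡ 0F z y) (trans (⊗-zeroˡ _) (sym (∙-0ˡ y))))) }) , eq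

    support-sum : prefixSupport 3 L * suc ρ + d' ≡ q ^ 3 * d'
    support-sum = *-cancelˡ-≡ _ _ (q ^ 2) {{m^n≢0 q 2}} (begin
      q ^ 2 * (prefixSupport 3 L * suc ρ + d')
        ≡⟨ alg (q ^ 2) (prefixSupport 3 L) (suc ρ) d' ⟩
      prefixSupport 3 L * (suc ρ * q ^ 2) + d
        ≡⟨ cong (_+ d) (∑-weight-prefix 2 L) ⟨
      ∑ E (λ v → weight L (v ++ 0ⱽ)) + d
        ≡⟨ cong (∑ E (λ v → weight L (v ++ 0ⱽ)) +_) (Enumeration.∑-point (𝕍 3) (λ _ → d) 0ⱽ) ⟨
      ∑ E (λ v → weight L (v ++ 0ⱽ)) + ∑ E (λ v → ⟦ v ≟ⱽ 0ⱽ ⟧ * d)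
        ≡⟨ ∑-+ E _ _ ⟨
      ∑ E (λ v → weight L (v ++ 0ⱽ) + ⟦ v ≟ⱽ 0ⱽ ⟧ * d)
        ≡⟨ ∑-cong E pointwise ⟩
      ∑ E (λ _ → d)
        ≡⟨ ∑𝕍-const 3 d ⟩
      q ^ 3 * d
        ≡⟨ alg' (q ^ 3) (q ^ 2) d' ⟩
      q ^ 2 * (q ^ 3 * d') ∎)
      where
      open ≡-Reasoning
      alg : ∀ a n b e → a * (n * b + e) ≡ n * (b * a) + a * e
      alg = solve-∀
      alg' : ∀ a b e → a * (b * e) ≡ b * (a * e)
      alg' = solve-∀
      pointwise : ∀ v → weight L (v ++ 0ⱽ) + ⟦ v ≟ⱽ 0ⱽ ⟧ * d ≡ d
      pointwise v with v ≟ⱽ 0ⱽ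
      ... | yes refl = cong₂ _+_ weight-0++0 (+-identityʳ d)
      ... | no v≢0   = trans (+-identityʳ _) (const v v≢0)

    -- Sum the weights over the plane orthogonal to `z`: a column not proportional to `z` is nonzero
    -- at (q-1) q of its vectors, and the q^2 - 1 nonzero messages in the plane have weight d each.
    off-sum : M * suc ρ + q * d' ≤ q ^ 3 * d'
    off-sum = *-cancelˡ-≤ q (begin
      q * (M * suc ρ + q * d')
        ≡⟨ alg q M (suc ρ) d' ⟩
      suc ρ * q ^ 1 * M + d
        ≡⟨ cong (_+ d) (∑-* L (suc ρ * q ^ 1) _) ⟨
      ∑ L (λ c → suc ρ * q ^ 1 * ⟦ ¬? (take 3 c ∝? z) ⟧) + d
        ≤⟨ +-monoˡ-≤ d (∑-mono L (λ c → column (take 3 c))) ⟩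
      ∑ L (λ c → ∑ E (λ v → ⟦ z ∙ v ≟ 0F ⟧ * nz (take 3 c ∙ v))) + d
        ≡⟨ cong (_+ d) (∑-comm L E _) ⟩
      ∑ E (λ v → ∑ L (λ c → ⟦ z ∙ v ≟ 0F ⟧ * nz (take 3 c ∙ v))) + d
        ≡⟨ cong (_+ d) (∑-cong E (λ v → trans (∑-* L ⟦ z ∙ v ≟ 0F ⟧ _)
             (cong (⟦ z ∙ v ≟ 0F ⟧ *_) (∑-cong L (λ c → cong nz (trans (∙-comm (take 3 c) v) (sym (++0-∙ 3 v c)))))))) ⟩
      ∑ E (λ v → ⟦ z ∙ v ≟ 0F ⟧ * weight L (v ++ 0ⱽ)) + d
        ≡⟨ cong (∑ E (λ v → ⟦ z ∙ v ≟ 0F ⟧ * weight L (v ++ 0ⱽ)) +_) (Enumeration.∑-point (𝕍 3) (λ _ → d) 0ⱽ) ⟨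
      ∑ E (λ v → ⟦ z ∙ v ≟ 0F ⟧ * weight L (v ++ 0ⱽ)) + ∑ E (λ v → ⟦ v ≟ⱽ 0ⱽ ⟧ * d)
        ≡⟨ ∑-+ E _ _ ⟨
      ∑ E (λ v → ⟦ z ∙ v ≟ 0F ⟧ * weight L (v ++ 0ⱽ) + ⟦ v ≟ⱽ 0ⱽ ⟧ * d)
        ≡⟨ ∑-cong E pointwise ⟩
      ∑ E (λ v → d * ⟦ z ∙ v ≟ 0F ⟧)
        ≡⟨ ∑-* E d _ ⟩
      d * ∑ E (λ v → ⟦ z ∙ v ≟ 0F ⟧)
        ≡⟨ cong (d *_) (∑-hyperplane-1 z z≢0) ⟩
      d * q ^ 2
        ≡⟨ alg' q d' ⟩
      q * (q ^ 3 * d') ∎)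
      where
      open ≤-Reasoning
      alg : ∀ a m b e → a * (m * b + a * e) ≡ b * (a * 1) * m + a * (a * 1) * e
      alg = solve-∀
      alg' : ∀ a e → a * (a * 1) * e * (a * (a * 1)) ≡ a * (a * (a * (a * 1)) * e)
      alg' = solve-∀
      column : ∀ (y : V 3) → suc ρ * q ^ 1 * ⟦ ¬? (y ∝? z) ⟧ ≤ ∑ E (λ v → ⟦ z ∙ v ≟ 0F ⟧ * nz (y ∙ v))
      column y with y ∝? z
      ... | yes _  = ≤-trans (≤-reflexive (*-zeroʳ (suc ρ * q ^ 1))) z≤n
      ... | no y∝̸z = ≤-reflexive (trans (*-identityʳ (suc ρ * q ^ 1)) (sym (∑-hyperplane-nz-≡ z y z≢0 y∝̸z)))
      pointwise : ∀ v → ⟦ z ∙ v ≟ 0F ⟧ * weight L (v ++ 0ⱽ) + ⟦ v ≟ⱽ 0ⱽ ⟧ * d ≡ d * ⟦ z ∙ v ≟ 0F ⟧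
      pointwise v with v ≟ⱽ 0ⱽ
      ... | yes refl = trans (cong₂ _+_ (trans (cong (⟦ z ∙ 0ⱽ ≟ 0F ⟧ *_) weight-0++0) (*-zeroʳ ⟦ z ∙ 0ⱽ ≟ 0F ⟧)) (*-comm 1 d))
                         (cong (d *_) (sym (⟦⟧-yes (z ∙ 0ⱽ ≟ 0F) (∙-0ʳ z))))
      ... | no v≢0   = trans (+-identityʳ _) (trans (cong (⟦ z ∙ v ≟ 0F ⟧ *_) (const v v≢0)) (*-comm ⟦ z ∙ v ≟ 0F ⟧ d))

    -- Subtract `off-sum` from `support-sum`: (q-1) A is at least (q^3 - 1) d' - (q^3 - q) d' =
    -- (q-1) d'.
    aligned-count : d' ≤ A
    aligned-count = *-cancelˡ-≤ (suc ρ) (+-cancelˡ-≤ (M * suc ρ + d') _ _ (begin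
      M * suc ρ + d' + suc ρ * d'               ≡⟨ alg (M * suc ρ) ρ d' ⟩
      M * suc ρ + (2 + ρ) * d'                  ≡⟨ cong (λ x → M * suc ρ + x * d') q≡2+ρ ⟨
      M * suc ρ + q * d'                        ≤⟨ off-sum ⟩
      q ^ 3 * d'                                ≡⟨ support-sum ⟨
      prefixSupport 3 L * suc ρ + d'            ≤⟨ +-monoˡ-≤ d' (*-monoˡ-≤ (suc ρ) support-≤) ⟩
      (A + M) * suc ρ + d'                      ≡⟨ alg' A M (suc ρ) d' ⟩
      M * suc ρ + d' + suc ρ * A                ∎))
      where
      open ≤-Reasoning
      alg : ∀ m r e → m + e + (1 + r) * e ≡ m + (2 + r) * e
      alg = solve-∀
      alg' : ∀ a m b e → (a + m) * b + e ≡ m * b + e + b * a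
      alg' = solve-∀

  -- A second moment count in F³

  2mn≤m²+n² : ∀ m n → 2 * m * n ≤ n * n + m * m
  2mn≤m²+n² m n with ≤-total m n
  ... | inj₁ m≤n = subst (λ n → 2 * m * n ≤ n * n + m * m) (m+[n∸m]≡n m≤n)
          (≤-trans (m≤m+n _ _) (≤-reflexive (alg m (n ∸ m))))
    where
    alg : ∀ m k → 2 * m * (m + k) + k * k ≡ (m + k) * (m + k) + m * m
    alg = solve-∀
  ... | inj₂ n≤m = subst (λ m → 2 * m * n ≤ n * n + m * m) (m+[n∸m]≡n n≤m)
          (≤-trans (m≤m+n _ _) (≤-reflexive (alg n (m ∸ n))))
    where
    alg : ∀ n k → 2 * (n + k) * n + k * k ≡ n * n + (n + k) * (n + k)
    alg = solve-∀

  -- If the normalisations y z = z / η z failed to take all values on each v ≠ 0, the collisions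
  -- v ∙ y z = v ∙ y z' ≠ 0 would outnumber what pairwise independence allows.
  module Surjectivity (η : V 3 → F) (η≢0 : ∀ z → z ≢ 0ⱽ → η z ≢ 0F) where

    y : V 3 → V 3
    y z = η z ⁻¹ ·ⱽ z

    private
      B : ℕ
      B = suc ρ * q ^ 2

    collisions : V 3 → ℕ
    collisions v = ∑ E (λ z → nz (v ∙ y z) * ∑ E (λ z' → ⟦ v ∙ y z ≟ v ∙ y z' ⟧))

    -- Holds whatever `η 0ⱽ` is; hence the value 0 is always attained, and a missed value is
    -- nonzero.
    y-0 : y 0ⱽ ≡ 0ⱽ
    y-0 = nondegenerate _ _ λ x → trans (∙-·ˡ (η 0ⱽ ⁻¹) 0ⱽ x)
      (trans (cong (η 0ⱽ ⁻¹ ⊗_) (∙-0ˡ x)) (trans (⊗-zeroʳ _) (sym (∙-0ˡ x))))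

    ∙y : ∀ v z → v ∙ y z ≡ η z ⁻¹ ⊗ v ∙ z
    ∙y v z = ∙-·ʳ (η z ⁻¹) v z

    ∑-nz-∙y : ∀ v → v ≢ 0ⱽ → ∑ E (λ z → nz (v ∙ y z)) ≡ B
    ∑-nz-∙y v v≢0 = trans (∑-cong E same) (∑-nz-∙ v v≢0)
      where
      same : ∀ z → nz (v ∙ y z) ≡ nz (v ∙ z)
      same z with z ≟ⱽ 0ⱽ
      ... | yes refl = cong (λ c → nz (v ∙ c)) y-0
      ... | no z≢0   = ⟦⟧-cong (¬? (v ∙ y z ≟ 0F)) (¬? (v ∙ z ≟ 0F))
        (λ ne e → ne (trans (∙y v z) (trans (cong (η z ⁻¹ ⊗_) e) (⊗-zeroʳ _))))
        (λ ne e → ⊗-≢0 (⁻¹-≢0 (η≢0 z z≢0)) ne (trans (sym (∙y v z)) e))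

    -- Cauchy-Schwarz without division: N^2 ≥ 2 m N - m^2 for each fibre size N, summed over the `ρ`
    -- nonzero values other than `β`. These fibres contain all `B` vectors with nonzero value.
    collisions-lower : ∀ v → v ≢ 0ⱽ → ∀ β → (∀ z → v ∙ y z ≢ β) → ∀ m → 2 * m * B ≤ collisions v + ρ * (m * m)
    collisions-lower v v≢0 β miss m = begin
      2 * m * B                                              ≡⟨ cong (2 * m *_) χN ⟨
      2 * m * ∑ elemsF (λ c → χ c * N c)                     ≡⟨ ∑-* elemsF (2 * m) _ ⟨
      ∑ elemsF (λ c → 2 * m * (χ c * N c))                   ≤⟨ ∑-mono elemsF pointwise ⟩
      ∑ elemsF (λ c → χ c * (N c * N c) + m * m * χ c)       ≡⟨ ∑-+ elemsF _ _ ⟩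
      ∑ elemsF (λ c → χ c * (N c * N c)) + ∑ elemsF (λ c → m * m * χ c)
        ≡⟨ cong₂ _+_ χN² (trans (∑-* elemsF (m * m) χ) (trans (cong (m * m *_) Σχ) (*-comm (m * m) ρ))) ⟩
      collisions v + ρ * (m * m)                             ∎
      where
      open ≤-Reasoning
      N χ : F → ℕ
      N c = ∑ E (λ z → ⟦ c ≟ v ∙ y z ⟧)
      χ c = nz c * ⟦ ¬? (c ≟ β) ⟧
      β≢0 : β ≢ 0F
      β≢0 refl = miss 0ⱽ (trans (cong (v ∙_) y-0) (∙-0ʳ v))
      χ-value : ∀ z → χ (v ∙ y z) ≡ nz (v ∙ y z)
      χ-value z = trans (cong (nz (v ∙ y z) *_) (⟦⟧-yes (¬? (v ∙ y z ≟ β)) (miss z))) (*-identityʳ _)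
      Σχ : ∑ elemsF χ ≡ ρ
      Σχ = +-cancelʳ-≡ 1 _ _ (trans (cong (∑ elemsF χ +_) (sym (Enumeration.once 𝔽 β)))
        (trans (sym (∑-+ elemsF χ _)) (trans (∑-cong elemsF split) (trans ∑-nz (+-comm 1 ρ)))))
        where
        split : ∀ c → χ c + ⟦ c ≟ β ⟧ ≡ nz c
        split c with c ≟ β
        ... | yes refl = trans (cong (_+ 1) (*-zeroʳ (nz c))) (sym (nz-≢0 β≢0))
        ... | no _     = trans (+-identityʳ _) (*-identityʳ (nz c))
      exchange : (f : F → ℕ) → ∑ elemsF (λ c → N c * f c) ≡ ∑ E (λ z → f (v ∙ y z))
      exchange f = begin-equality
        ∑ elemsF (λ c → N c * f c)
          ≡⟨ ∑-cong elemsF (λ c → trans (*-comm (N c) (f c)) (sym (∑-* E (f c) _))) ⟩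
        ∑ elemsF (λ c → ∑ E (λ z → f c * ⟦ c ≟ v ∙ y z ⟧))
          ≡⟨ ∑-comm elemsF E _ ⟩
        ∑ E (λ z → ∑ elemsF (λ c → f c * ⟦ c ≟ v ∙ y z ⟧))
          ≡⟨ ∑-cong E (λ z → trans (∑-cong elemsF (λ c → *-comm (f c) _)) (Enumeration.∑-point 𝔽 f (v ∙ y z))) ⟩
        ∑ E (λ z → f (v ∙ y z)) ∎
      χN : ∑ elemsF (λ c → χ c * N c) ≡ B
      χN = trans (∑-cong elemsF (λ c → *-comm (χ c) (N c)))
        (trans (exchange χ) (trans (∑-cong E χ-value) (∑-nz-∙y v v≢0)))
      χN² : ∑ elemsF (λ c → χ c * (N c * N c)) ≡ collisions v
      χN² = trans (∑-cong elemsF (λ c → alg (χ c) (N c)))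
        (trans (exchange (λ c → χ c * N c)) (∑-cong E (λ z → cong (_* N (v ∙ y z)) (χ-value z))))
        where
        alg : ∀ a n → a * (n * n) ≡ n * (a * n)
        alg = solve-∀
      pointwise : ∀ c → 2 * m * (χ c * N c) ≤ χ c * (N c * N c) + m * m * χ c
      pointwise c = ≤-trans (≤-reflexive (alg m (χ c) (N c)))
        (≤-trans (*-monoʳ-≤ (χ c) (2mn≤m²+n² m (N c))) (≤-reflexive (alg' m (χ c) (N c))))
        where
        alg : ∀ m a n → 2 * m * (a * n) ≡ a * (2 * m * n)
        alg = solve-∀
        alg' : ∀ m a n → a * (n * n + m * m) ≡ a * (n * n) + m * m * a
        alg' = solve-∀

    -- If y z and y z' differ, a colliding `v` lies in the plane orthogonal to their difference. If
    -- they agree, every `v` with nonzero value collides, but then `z'` is one of at most q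
    -- multiples of `y z`.
    pair-collisions : ∀ z z' → ∑ E (λ v → nz (v ∙ y z) * ⟦ v ∙ y z ≟ v ∙ y z' ⟧) ≤ B * ⟦ z' ∝? y z ⟧ + suc ρ * q ^ 1
    pair-collisions z z' with y z ≟ⱽ y z'
    ... | yes yz≡yz' = ≤-trans (≤-trans bound (≤-reflexive (trans (sym (*-identityʳ B))
            (cong (B *_) (sym (⟦⟧-yes (z' ∝? y z) proportional)))))) (m≤m+n _ _)
      where
      bound : ∑ E (λ v → nz (v ∙ y z) * ⟦ v ∙ y z ≟ v ∙ y z' ⟧) ≤ B
      bound = ≤-trans (∑-mono E (λ v → ≤-trans
          (*-monoʳ-≤ (nz (v ∙ y z)) (⟦⟧≤1 (v ∙ y z ≟ v ∙ y z')))
          (≤-reflexive (trans (*-identityʳ _) (cong nz (∙-comm v (y z)))))))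
        (∑-nz-∙-≤ (y z))
      proportional : z' ∝ y z
      proportional with z' ≟ⱽ 0ⱽ
      ... | yes refl = 0F , nondegenerate _ _ (λ x → trans (∙-0ˡ x)
              (sym (trans (∙-·ˡ 0F (y z) x) (⊗-zeroˡ _))))
      ... | no z'≢0 = η z' , trans (sym (·-⁻¹ (η≢0 z' z'≢0) z')) (cong (η z' ·ⱽ_) (sym yz≡yz'))
    ... | no yz≢yz' = ≤-trans (∑-mono E pointwise) (≤-trans (∑-hyperplane-nz-≤ w (y z) w≢0) (m≤n+m _ (B * ⟦ z' ∝? y z ⟧)))
      where
      w : V 3
      w = y z +ⱽ ⊖ 1F ·ⱽ y z'
      w∙ : ∀ x → w ∙ x ≡ y z ∙ x ⊕ neg (y z' ∙ x)
      w∙ x = trans (∙-+ˡ (y z) _ x) (cong (y z ∙ x ⊕_) (∙-·ˡ (⊖ 1F) (y z') x))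
      w≢0 : w ≢ 0ⱽ
      w≢0 w≡0 = yz≢yz' (nondegenerate _ _ λ x → begin
        y z ∙ x                                     ≡⟨ neg-⊕-cancel (y z ∙ x) (y z' ∙ x) ⟨
        y z ∙ x ⊕ neg (y z' ∙ x) ⊕ y z' ∙ x         ≡⟨ cong (_⊕ y z' ∙ x) (w∙ x) ⟨
        w ∙ x ⊕ y z' ∙ x                            ≡⟨ cong (_⊕ y z' ∙ x) (trans (cong (_∙ x) w≡0) (∙-0ˡ x)) ⟩
        0F ⊕ y z' ∙ x                               ≡⟨ ⊕-identityˡ _ ⟩
        y z' ∙ x                                    ∎)
        where open ≡-Reasoning
      pointwise : ∀ v → nz (v ∙ y z) * ⟦ v ∙ y z ≟ v ∙ y z' ⟧ ≤ ⟦ w ∙ v ≟ 0F ⟧ * nz (y z ∙ v)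
      pointwise v = ≤-trans (≤-reflexive (*-comm (nz (v ∙ y z)) _))
        (*-mono-≤ (⟦⟧-mono (v ∙ y z ≟ v ∙ y z') (w ∙ v ≟ 0F) orthogonal)
          (≤-reflexive (cong nz (∙-comm v (y z)))))
        where
        orthogonal : v ∙ y z ≡ v ∙ y z' → w ∙ v ≡ 0F
        orthogonal e = trans (w∙ v) (trans (cong (_⊕ neg (y z' ∙ v))
          (trans (∙-comm (y z) v) (trans e (∙-comm v (y z'))))) (⊕-neg (y z' ∙ v)))

    ∑-∝ : ∀ (x : V 3) → ∑ E (λ z → ⟦ z ∝? x ⟧) ≤ q
    ∑-∝ x = begin
      ∑ E (λ z → ⟦ z ∝? x ⟧)                                 ≤⟨ ∑-mono E pointwise ⟩
      ∑ E (λ z → ∑ elemsF (λ a → ⟦ z ≟ⱽ a ·ⱽ x ⟧))           ≡⟨ ∑-comm E elemsF _ ⟩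
      ∑ elemsF (λ a → ∑ E (λ z → ⟦ z ≟ⱽ a ·ⱽ x ⟧))           ≡⟨ ∑-cong elemsF (λ a → Enumeration.once (𝕍 3) (a ·ⱽ x)) ⟩
      ∑ elemsF (λ _ → 1)                                     ≡⟨ ∑𝔽-const 1 ⟩
      q * 1                                                  ≡⟨ *-identityʳ q ⟩
      q                                                      ∎
      where
      open ≤-Reasoning
      pointwise : ∀ z → ⟦ z ∝? x ⟧ ≤ ∑ elemsF (λ a → ⟦ z ≟ⱽ a ·ⱽ x ⟧)
      pointwise z with z ∝? x
      ... | no _ = z≤n
      ... | yes (a , eq) = ≤-trans (≤-reflexive (sym (⟦⟧-yes (z ≟ⱽ a ·ⱽ x) eq)))
              (∑-≥∈ (λ a → ⟦ z ≟ⱽ a ·ⱽ x ⟧) (Enumeration.complete 𝔽 a))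

    collisions-upper : ∑ E collisions ≤ q ^ 3 * (B * q + q ^ 3 * (suc ρ * q ^ 1))
    collisions-upper = begin
      ∑ E collisions
        ≡⟨ ∑-cong E (λ v → ∑-cong E (λ z → sym (∑-* E (nz (v ∙ y z)) _))) ⟩
      ∑ E (λ v → ∑ E (λ z → ∑ E (λ z' → nz (v ∙ y z) * ⟦ v ∙ y z ≟ v ∙ y z' ⟧)))
        ≡⟨ ∑-comm E E _ ⟩
      ∑ E (λ z → ∑ E (λ v → ∑ E (λ z' → nz (v ∙ y z) * ⟦ v ∙ y z ≟ v ∙ y z' ⟧)))
        ≡⟨ ∑-cong E (λ z → ∑-comm E E _) ⟩
      ∑ E (λ z → ∑ E (λ z' → ∑ E (λ v → nz (v ∙ y z) * ⟦ v ∙ y z ≟ v ∙ y z' ⟧)))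
        ≤⟨ ∑-mono E (λ z → ∑-mono E (pair-collisions z)) ⟩
      ∑ E (λ z → ∑ E (λ z' → B * ⟦ z' ∝? y z ⟧ + suc ρ * q ^ 1))
        ≡⟨ ∑-cong E (λ z → trans (∑-+ E _ _) (cong₂ _+_ (∑-* E B _) (∑𝕍-const 3 (suc ρ * q ^ 1)))) ⟩
      ∑ E (λ z → B * ∑ E (λ z' → ⟦ z' ∝? y z ⟧) + q ^ 3 * (suc ρ * q ^ 1))
        ≤⟨ ∑-mono E (λ z → +-monoˡ-≤ (q ^ 3 * (suc ρ * q ^ 1)) (*-monoʳ-≤ B (∑-∝ (y z)))) ⟩
      ∑ E (λ _ → B * q + q ^ 3 * (suc ρ * q ^ 1))
        ≡⟨ ∑𝕍-const 3 _ ⟩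
      q ^ 3 * (B * q + q ^ 3 * (suc ρ * q ^ 1)) ∎
      where open ≤-Reasoning

    surjective : ∃ λ v → v ≢ 0ⱽ × (∀ β → ∃ λ z → v ∙ y z ≡ β)
    surjective with Enumeration.any? (𝕍 3) (λ v → ¬? (v ≟ⱽ 0ⱽ) ×-dec onto? v)
      where
      onto? : ∀ v → Dec (∀ β → ∃ λ z → v ∙ y z ≡ β)
      onto? v with Enumeration.any? 𝔽 (λ β → ¬? (Enumeration.any? (𝕍 3) (λ z → v ∙ y z ≟ β)))
      ... | yes (β , miss) = no (λ onto → miss (onto β))
      ... | no none = yes (λ β → decidable-stable (Enumeration.any? (𝕍 3) (λ z → v ∙ y z ≟ β)) (λ miss → none (β , miss)))
    ... | yes found = found
    ... | no none   = contradiction totals (<⇒≱ gap)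
      where
      open ≤-Reasoning
      m : ℕ
      -- The best parameter is the mean fibre size B/(q-2) = (q-1) q^2/(q-2). As q^2/(q-2) = q + 2 +
      -- 4/(q-2), its polynomial part (q-1)(q+2) is used, which also makes sense for q = 2.
      m = suc ρ * (4 + ρ)
      missed : ∀ v → v ≢ 0ⱽ → ∃ λ β → ∀ z → v ∙ y z ≢ β
      missed v v≢0 with Enumeration.any? 𝔽 (λ β → ¬? (Enumeration.any? (𝕍 3) (λ z → v ∙ y z ≟ β)))
      ... | yes (β , miss) = β , λ z e → miss (z , e)
      ... | no hit = contradiction (v , v≢0 , λ β → decidable-stable (Enumeration.any? (𝕍 3) (λ z → v ∙ y z ≟ β))
              (λ miss → hit (β , miss))) none
      pointwise : ∀ v → 2 * m * B ≤ collisions v + ρ * (m * m) + ⟦ v ≟ⱽ 0ⱽ ⟧ * (2 * m * B)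
      pointwise v with v ≟ⱽ 0ⱽ
      ... | yes _  = ≤-trans (≤-reflexive (sym (+-identityʳ (2 * m * B)))) (m≤n+m (2 * m * B + 0) (collisions v + ρ * (m * m)))
      ... | no v≢0 = ≤-trans (collisions-lower v v≢0 (proj₁ (missed v v≢0)) (proj₂ (missed v v≢0)) m) (m≤m+n _ 0)
      totals : q ^ 3 * (2 * m * B) ≤ q ^ 3 * (B * q + q ^ 3 * (suc ρ * q ^ 1)) + q ^ 3 * (ρ * (m * m)) + 2 * m * B
      totals = begin
        q ^ 3 * (2 * m * B)
          ≡⟨ ∑𝕍-const 3 (2 * m * B) ⟨
        ∑ E (λ _ → 2 * m * B)
          ≤⟨ ∑-mono E pointwise ⟩
        ∑ E (λ v → collisions v + ρ * (m * m) + ⟦ v ≟ⱽ 0ⱽ ⟧ * (2 * m * B))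
          ≡⟨ trans (∑-+ E _ _) (cong₂ _+_ (∑-+ E _ _) (Enumeration.∑-point (𝕍 3) (λ _ → 2 * m * B) 0ⱽ)) ⟩
        ∑ E collisions + ∑ E (λ _ → ρ * (m * m)) + 2 * m * B
          ≤⟨ +-monoˡ-≤ (2 * m * B) (+-mono-≤ collisions-upper (≤-reflexive (∑𝕍-const 3 (ρ * (m * m))))) ⟩
        q ^ 3 * (B * q + q ^ 3 * (suc ρ * q ^ 1)) + q ^ 3 * (ρ * (m * m)) + 2 * m * B ∎
      gap : q ^ 3 * (B * q + q ^ 3 * (suc ρ * q ^ 1)) + q ^ 3 * (ρ * (m * m)) + 2 * m * B < q ^ 3 * (2 * m * B)
      gap = subst (λ q → q ^ 3 * (suc ρ * q ^ 2 * q + q ^ 3 * (suc ρ * q ^ 1)) + q ^ 3 * (ρ * (m * m)) + 2 * m * (suc ρ * q ^ 2)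
                         < q ^ 3 * (2 * m * (suc ρ * q ^ 2))) (sym q≡2+ρ)
        (≤-trans (m≤m+n _ _) (≤-reflexive (polynomial ρ)))
        where
        -- In the variable r = q - 2 the difference of the two sides has nonnegative coefficients;
        -- the leading 1 makes the inequality strict.
        polynomial : ∀ r →
          1 + ((2 + r) * ((2 + r) * ((2 + r) * 1)) * ((1 + r) * ((2 + r) * ((2 + r) * 1)) * (2 + r)
            + (2 + r) * ((2 + r) * ((2 + r) * 1)) * ((1 + r) * ((2 + r) * 1)))
            + (2 + r) * ((2 + r) * ((2 + r) * 1)) * (r * ((1 + r) * (4 + r) * ((1 + r) * (4 + r))))
            + 2 * ((1 + r) * (4 + r)) * ((1 + r) * ((2 + r) * ((2 + r) * 1))))
            + (31 + r * (152 + r * (272 + r * (238 + r * (108 + r * (24 + r * 2))))))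
          ≡ (2 + r) * ((2 + r) * ((2 + r) * 1)) * (2 * ((1 + r) * (4 + r)) * ((1 + r) * ((2 + r) * ((2 + r) * 1))))
        polynomial = solve-∀

  -- The induction

  neg-≢0 : ∀ {a} → a ≢ 0F → neg a ≢ 0F
  neg-≢0 {a} a≢0 e = a≢0 (trans (sym (⊕-identityʳ a)) (trans (cong (a ⊕_) (sym e)) (⊕-neg a)))

  -- The other words u + α v of the line are orthogonal to good points.
  cover : ∀ {Δ k} (L : Cols k) u v → Δ ∣ weight L v → Δ ∣ ∑ elemsF (λ a → weight L (u +ⱽ a ·ⱽ v)) + weight L v →
          (∀ β → β ≢ 0F → ∃ λ P → Good Δ L P × v ∙ P ≡ β ⊗ u ∙ P) → Δ ∣ weight L u
  cover {Δ} L u v Δ∣v total good =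
    subst (Δ ∣_) (∑-cong L (λ c → cong nz (at-0 c)))
      (Enumeration.∑-∣-but 𝔽 (λ a → weight L (u +ⱽ a ·ⱽ v)) 0F
        (∣m+n∣m⇒∣n (subst (Δ ∣_) (+-comm _ (weight L v)) total) Δ∣v) others)
    where
    at-0 : ∀ c → (u +ⱽ 0F ·ⱽ v) ∙ c ≡ u ∙ c
    at-0 c = trans (∙-+ˡ u (0F ·ⱽ v) c) (trans (cong (u ∙ c ⊕_) (trans (∙-·ˡ 0F v c) (⊗-zeroˡ _))) (⊕-identityʳ _))
    others : ∀ a → a ≢ 0F → Δ ∣ weight L (u +ⱽ a ·ⱽ v)
    -- If v·P = β u·P, then (u + a v)·P = (1 + a β) u·P, which suggests β = -1/a.
    others a a≢0 with good (neg (a ⁻¹)) (neg-≢0 (⁻¹-≢0 a≢0))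
    ... | P , gd , vP≡ = gd (u +ⱽ a ·ⱽ v) (begin
      (u +ⱽ a ·ⱽ v) ∙ P                          ≡⟨ ∙-+ˡ u (a ·ⱽ v) P ⟩
      u ∙ P ⊕ (a ·ⱽ v) ∙ P                       ≡⟨ cong (u ∙ P ⊕_) (trans (∙-·ˡ a v P) (cong (a ⊗_) vP≡)) ⟩
      u ∙ P ⊕ a ⊗ (neg (a ⁻¹) ⊗ u ∙ P)           ≡⟨ cong (u ∙ P ⊕_) (solveF 4 (λ a m i s → a :* (m :* i :* s) := m :* (a :* (i :* s)))
                                                      refl a (⊖ 1F) (a ⁻¹) (u ∙ P)) ⟩
      u ∙ P ⊕ neg (a ⊗ (a ⁻¹ ⊗ u ∙ P))           ≡⟨ cong (λ s → u ∙ P ⊕ neg s) (⁻¹-cancelˡ a≢0 (u ∙ P)) ⟩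
      u ∙ P ⊕ neg (u ∙ P)                        ≡⟨ ⊕-neg (u ∙ P) ⟩
      0F                                         ∎)
      where open ≡-Reasoning

  -- Fewer equations than unknowns. A nonzero first vector is normalised to `1F ∷ z`, and projecting
  -- the others from it eliminates one unknown.
  kernel : ∀ {m k} → m < k → (P : Fin m → V k) → ∃ λ w → w ≢ 0ⱽ × (∀ i → w ∙ P i ≡ 0F)
  kernel {zero}  {suc k} _ P = 1F ∷ 0ⱽ , 1∷0≢0 , λ ()
  kernel {suc m} {suc k} (s≤s m<k) P with P Fin.zero ≟ⱽ 0ⱽ
  ... | yes P₀≡0 with kernel (m<n⇒m<1+n m<k) (P ∘ Fin.suc)
  ...   | w , w≢0 , w⊥ = w , w≢0 , λ { Fin.zero → trans (cong (w ∙_) P₀≡0) (∙-0ʳ w) ; (Fin.suc i) → w⊥ i }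
  kernel {suc m} {suc k} (s≤s m<k) P | no P₀≢0 with ∃-∙≡1 (P Fin.zero) P₀≢0
  ... | c , cP₀≡1 = lift (kernel m<k (λ i → projectFrom z (τ (P (Fin.suc i)))))
    where
    c≢0 : c ≢ 0ⱽ
    c≢0 refl = 1≢0 (trans (sym cP₀≡1) (∙-0ˡ (P Fin.zero)))
    open Pivot (pivot c c≢0)
    z : V k
    z = tail (τ (P Fin.zero))
    lift : (∃ λ x → x ≢ 0ⱽ × (∀ i → x ∙ projectFrom z (τ (P (Fin.suc i))) ≡ 0F)) →
           ∃ λ w → w ≢ 0ⱽ × (∀ i → w ∙ P i ≡ 0F)
    lift (x , x≢0 , x⊥) = μ y , μ≢0 (λ e → x≢0 (cong tail e)) , λ
      { Fin.zero → trans (sym (adjτ y (P Fin.zero))) (trans (cong (y ∙_) (∷-η (τ (P Fin.zero)) (trans (head-τ (P Fin.zero)) cP₀≡1)))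
          (trans (cong (_⊕ x ∙ z) (⊗-identityʳ _)) (trans (⊕-comm _ _) (⊕-neg (x ∙ z)))))
      ; (Fin.suc i) → trans (sym (adjτ y (P (Fin.suc i)))) (trans (sym (∙-projectFrom z x (τ (P (Fin.suc i))))) (x⊥ i)) }
      where
      y : V (suc k)
      y = neg (x ∙ z) ∷ x

  -- Good points in triangular position, so that the ratios v ∙ P / u ∙ P can be prescribed.
  interpolate : ∀ {Δ k} (L : Cols k) u → (∀ w → w ≢ 0ⱽ → ∃ λ P → w ∙ P ≢ 0F × Good Δ L P) →
                ∀ m → m ≤ k → (b : Fin m → F) →
                Δ ∣ weight L u ⊎ Σ (Fin m → V k) λ P → ∃ λ v → ∀ i →
                  Good Δ L (P i) × u ∙ P i ≢ 0F × v ∙ P i ≡ b i ⊗ u ∙ P i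
  interpolate L u avoid zero    m≤k b = inj₂ ((λ ()) , 0ⱽ , λ ())
  interpolate {Δ} {k} L u avoid (suc m) m<k b with interpolate L u avoid m (<⇒≤ m<k) (b ∘ Fin.suc)
  ... | inj₁ done = inj₁ done
  -- Adding a multiple of `w` to `v` keeps the values at the earlier points and adjusts the one at
  -- `P₀`.
  ... | inj₂ (P , v , props) with kernel m<k P
  ...   | w , w≢0 , w⊥ with avoid w w≢0
  ...     | P₀ , wP₀≢0 , good₀ with u ∙ P₀ ≟ 0F
  -- Here `u` is itself orthogonal to a good point.
  ...       | yes uP₀≡0 = inj₁ (good₀ u uP₀≡0)
  ...       | no uP₀≢0 = inj₂ (P' , v +ⱽ a ·ⱽ w , λ
      { Fin.zero → good₀ , uP₀≢0 , (begin
          (v +ⱽ a ·ⱽ w) ∙ P₀                                   ≡⟨ v'∙ P₀ ⟩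
          v ∙ P₀ ⊕ (w ∙ P₀) ⁻¹ ⊗ target ⊗ w ∙ P₀               ≡⟨ cong (v ∙ P₀ ⊕_) (trans (⊗-comm _ (w ∙ P₀)) (⁻¹-cancelˡ wP₀≢0 target)) ⟩
          v ∙ P₀ ⊕ (b Fin.zero ⊗ u ∙ P₀ ⊕ neg (v ∙ P₀))        ≡⟨ ⊕-comm _ _ ⟩
          b Fin.zero ⊗ u ∙ P₀ ⊕ neg (v ∙ P₀) ⊕ v ∙ P₀          ≡⟨ neg-⊕-cancel _ (v ∙ P₀) ⟩
          b Fin.zero ⊗ u ∙ P₀                                  ∎)
      ; (Fin.suc i) → proj₁ (props i) , proj₁ (proj₂ (props i)) ,
          trans (v'∙ (P i)) (trans (cong (λ s → v ∙ P i ⊕ a ⊗ s) (w⊥ i))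
            (trans (cong (v ∙ P i ⊕_) (⊗-zeroʳ a)) (trans (⊕-identityʳ _) (proj₂ (proj₂ (props i)))))) })
    where
    open ≡-Reasoning
    target a : F
    target = b Fin.zero ⊗ u ∙ P₀ ⊕ neg (v ∙ P₀)
    a = (w ∙ P₀) ⁻¹ ⊗ target
    P' : Fin (suc m) → V k
    P' Fin.zero    = P₀
    P' (Fin.suc i) = P i
    v'∙ : ∀ x → (v +ⱽ a ·ⱽ w) ∙ x ≡ v ∙ x ⊕ a ⊗ w ∙ x
    v'∙ x = trans (∙-+ˡ v (a ·ⱽ w) x) (cong (v ∙ x ⊕_) (∙-·ˡ a w x))

  -- The good points are indexed by the field itself, with ratio equal to index. The point of ratio
  -- 0 makes the weight of `v` divisible, that of ratio 1 shows `v` nonzero, and the others serve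
  -- `cover`.
  divisible-small : ∀ {Δ k d} → Δ ∣ q → q ≤ suc k → 1 ≤ d → Divisible Δ k d → Divisible Δ (suc k) d
  divisible-small {Δ} {k} Δ∣q q≤k 1≤d IH L G u with interpolate L u (avoid IH 1≤d L G) q q≤k id
  ... | inj₁ done = done
  ... | inj₂ (P , v , props) = cover L u v
      (good 0F v (trans (v∙P 0F) (⊗-zeroˡ _)))
      (subst (Δ ∣_) (sym (∑-line (pivot v v≢0) L u)) (∣m⇒∣m*n _ Δ∣q))
      (λ β _ → P β , good β , v∙P β)
    where
    good : ∀ i → Good Δ L (P i)
    good i = proj₁ (props i)
    v∙P : ∀ i → v ∙ P i ≡ i ⊗ u ∙ P i
    v∙P i = proj₂ (proj₂ (props i))
    v≢0 : v ≢ 0ⱽ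
    v≢0 refl = proj₁ (proj₂ (props 1F)) (trans (sym (⊗-identityˡ _)) (trans (sym (v∙P 1F)) (∙-0ˡ (P 1F))))

  -- Passing to the residual code costs a factor q in the distance and so in the divisor; the factor
  -- q in the line identity restores it.
  ∣-line : ∀ {Δ Δ' k d'} (L : Cols (suc k)) → Griesmer (suc k) (q * d') L → Δ ∣ q * d' → Δ ∣ q * Δ' →
           Divisible Δ' k d' → ∀ u v → v ≢ 0ⱽ → weight L v ≡ q * d' →
           Δ ∣ ∑ elemsF (λ a → weight L (u +ⱽ a ·ⱽ v)) + weight L v
  ∣-line {Δ} {Δ'} {k} {d'} L G Δ∣d Δ∣qΔ' IH u v v≢0 wt≡ =
    subst (Δ ∣_) (sym (trans (∑-line (pivot v v≢0) L u) (*-distribˡ-+ q (weight L v) _)))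
      (∣m∣n⇒∣m+n (subst (λ x → Δ ∣ q * x) (sym wt≡) (∣n⇒∣m*n q Δ∣d))
        (∣-trans Δ∣qΔ' (*-monoʳ-∣ q (IH _ residual (tail (Pivot.ν (pivot v v≢0) u))))))
    where
    residual : Griesmer k d' (res (map (Pivot.τ (pivot v v≢0)) L))
    residual = subst (λ x → Griesmer k x (res (map (Pivot.τ (pivot v v≢0)) L))) (⌈/⌉-exact d' q)
      (Griesmer-res (Griesmer-τ (Pivot.basis (pivot v v≢0)) G) (trans (headWt-pivot (pivot v v≢0) L) wt≡))

  module _ {Δ k d'} (1≤d' : 1 ≤ d') (IH : Divisible Δ (2 + k) (q ^ 2 * d')) (L : Cols (3 + k))
           (G : Griesmer (3 + k) (q ^ 2 * d') L)
           (const : ∀ (v : V 3) → v ≢ 0ⱽ → weight L (v ++ 0ⱽ) ≡ q ^ 2 * d') where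

    -- Cancelling q^2 in the threshold for a good point leaves exactly the bound `d'` on the number
    -- of columns over `z`.
    good-over : ∀ (z : V 3) → z ≢ 0ⱽ → ∃ λ (t : V k) → Good Δ L (z ++ t)
    good-over z z≢0 = from-gap (⌈/⌉-gap (q ^ (2 + k)) {{m^n≢0 q (2 + k)}} 1≤d)
      where
      1≤d : 1 ≤ q ^ 2 * d'
      1≤d = *-mono-≤ (m^n>0 q 2) 1≤d'
      z++t≢0 : ∀ (t : V k) → z ++ t ≢ 0ⱽ
      z++t≢0 t e = z≢0 (trans (sym (take-++ 3 z t)) (cong (take 3) e))
      from-gap : (∃ λ m → suc m ≡ ⌈ q ^ 2 * d' / q ^ (2 + k) ⌉ × m * q ^ (2 + k) < q ^ 2 * d') →
                 ∃ λ (t : V k) → Good Δ L (z ++ t)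
      from-gap (m , suc-m≡ , m*<d) = from-heavy (heavy-point 3 L z m (<-≤-trans m*<d' (aligned-count d' L const z z≢0)))
        where
        alg : ∀ m a x → m * (a * x) ≡ a * (m * x)
        alg = solve-∀
        m*<d' : m * q ^ k < d'
        m*<d' = *-cancelˡ-< (q ^ 2) (m * q ^ k) d' (subst (_< q ^ 2 * d')
          (trans (cong (m *_) (^-distribˡ-+-* q 2 k)) (alg m (q ^ 2) (q ^ k))) m*<d)
        from-heavy : (∃ λ (t : V k) → m < mult L (z ++ t)) → ∃ λ (t : V k) → Good Δ L (z ++ t)
        from-heavy (t , m<mult) =
          t , good-point IH L (z ++ t) (z++t≢0 t) G (≤-trans (≤-reflexive (sym suc-m≡)) m<mult)

    module _ (u : V (3 + k)) (t : V 3 → V k) (good : ∀ z → z ≢ 0ⱽ → Good Δ L (z ++ t z))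
             (line : ∀ (v : V 3) → v ≢ 0ⱽ → Δ ∣ ∑ elemsF (λ a → weight L (u +ⱽ a ·ⱽ (v ++ 0ⱽ))) + weight L (v ++ 0ⱽ))
             (Δ∣d : Δ ∣ q ^ 2 * d') where

      private
        η : V 3 → F
        η z = u ∙ (z ++ t z)

      good-ratio : (∀ z → z ≢ 0ⱽ → η z ≢ 0F) → ∀ v β → β ≢ 0F → (∃ λ z → v ∙ (η z ⁻¹ ·ⱽ z) ≡ β) →
                   ∃ λ P → Good Δ L P × (v ++ 0ⱽ) ∙ P ≡ β ⊗ u ∙ P
      good-ratio η≢0 v β β≢0 (z , hit) = z ++ t z , good z z≢0 , (begin
        (v ++ 0ⱽ) ∙ (z ++ t z)       ≡⟨ trans (++0-∙ 3 v (z ++ t z)) (cong (v ∙_) (take-++ 3 z (t z))) ⟩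
        v ∙ z                        ≡⟨ ⁻¹-cancelˡ (η≢0 z z≢0) (v ∙ z) ⟨
        η z ⊗ (η z ⁻¹ ⊗ v ∙ z)       ≡⟨ cong (η z ⊗_) (trans (sym (∙-·ʳ (η z ⁻¹) v z)) hit) ⟩
        η z ⊗ β                      ≡⟨ ⊗-comm (η z) β ⟩
        β ⊗ η z                      ∎)
        where
        open ≡-Reasoning
        z≢0 : z ≢ 0ⱽ
        z≢0 refl = β≢0 (trans (sym hit) (trans (∙-·ʳ (η 0ⱽ ⁻¹) v 0ⱽ)
          (trans (cong (η 0ⱽ ⁻¹ ⊗_) (∙-0ʳ v)) (⊗-zeroʳ _))))

      divisible-at : Δ ∣ weight L u
      divisible-at = goal (Enumeration.any? (𝕍 3) (λ z → ¬? (z ≟ⱽ 0ⱽ) ×-dec (η z ≟ 0F)))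
        where
        conclude : (∀ z → z ≢ 0ⱽ → η z ≢ 0F) →
                   (∃ λ v → v ≢ 0ⱽ × (∀ β → ∃ λ z → v ∙ (η z ⁻¹ ·ⱽ z) ≡ β)) → Δ ∣ weight L u
        conclude η≢0 (v , v≢0 , onto) = cover L u (v ++ 0ⱽ) (subst (Δ ∣_) (sym (const v v≢0)) Δ∣d)
          (line v v≢0) (λ β β≢0 → good-ratio η≢0 v β β≢0 (onto β))
        goal : Dec (∃ λ z → z ≢ 0ⱽ × η z ≡ 0F) → Δ ∣ weight L u
        goal (yes (z , z≢0 , ηz≡0)) = good z z≢0 u ηz≡0
        goal (no none) = conclude η≢0 (Surjectivity.surjective η η≢0)
          where
          η≢0 : ∀ z → z ≢ 0ⱽ → η z ≢ 0F
          η≢0 z z≢0 ηz≡0 = none (z , z≢0 , ηz≡0)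

  -- The two hypotheses one dimension lower have separate tasks: the one with distance d makes heavy
  -- points good, and the one with distance d/q controls the residual codes.
  divisible-large : ∀ {Δ Δ' k d'} → 1 ≤ d' → Δ ∣ q * (q * d') → Δ ∣ q * Δ' →
                    Divisible Δ (2 + k) (q * (q * d')) → Divisible Δ' (2 + k) (q * d') →
                    Divisible Δ (3 + k) (q * (q * d'))
  divisible-large {Δ} {Δ'} {k} {d'} 1≤d' Δ∣d Δ∣qΔ' IH IH' L₀ G₀ u₀ with flag 3 k L₀ G₀
  ... | B , small = subst (Δ ∣_) (weight-ν B L₀ u₀) (divisible-at {k = k} 1≤d' IH² L L-Griesmer² const u
          (λ z → proj₁ (point z)) (λ z → proj₂ (point z))
          (λ v v≢0 → ∣-line L L-Griesmer Δ∣d Δ∣qΔ' IH' u (v ++ 0ⱽ) (++0≢0 v v≢0) (trans (const v v≢0) (sym d≡)))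
          (subst (Δ ∣_) d≡ Δ∣d))
    where
    d≡ : q * (q * d') ≡ q ^ 2 * d'
    d≡ = trans (sym (*-assoc q q d')) (cong (λ x → q * x * d') (sym (*-identityʳ q)))
    L : Cols (3 + k)
    L = map (Basis.τ B) L₀
    u : V (3 + k)
    u = Basis.ν B u₀
    L-Griesmer : Griesmer (3 + k) (q * (q * d')) L
    L-Griesmer = Griesmer-τ B G₀
    L-Griesmer² : Griesmer (3 + k) (q ^ 2 * d') L
    L-Griesmer² = subst (λ x → Griesmer (3 + k) x L) d≡ L-Griesmer
    IH² : Divisible Δ (2 + k) (q ^ 2 * d')
    IH² = subst (Divisible Δ (2 + k)) d≡ IH
    const : ∀ (v : V 3) → v ≢ 0ⱽ → weight L (v ++ 0ⱽ) ≡ q ^ 2 * d'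
    const = constant-weight 2 d' L (Griesmer.minWt L-Griesmer²)
      (subst (λ x → prefixSupport 3 L ≤ griesmer q 3 x) d≡ small)
    point : ∀ (z : V 3) → ∃ λ (t : V k) → z ≢ 0ⱽ → Good Δ L (z ++ t)
    point z with z ≟ⱽ 0ⱽ
    ... | yes z≡0 = 0ⱽ , λ z≢0 → contradiction z≡0 z≢0
    ... | no z≢0  = proj₁ found , λ _ → proj₂ found
      where
      found : ∃ λ (t : V k) → Good Δ L (z ++ t)
      found = good-over 1≤d' IH² L L-Griesmer² const z z≢0

  -- The prefix is the whole column, so the length bound plays the part that `flag` has in higher
  -- dimension.
  divisible-plane : ∀ {Δ d'} → Δ ∣ q * d' → Divisible Δ 2 (q * d')
  divisible-plane {Δ} {d'} Δ∣d L G x with x ≟ⱽ 0ⱽ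
  ... | yes refl = subst (Δ ∣_) (sym (weight-0 L)) (Δ ∣0)
  ... | no x≢0   = subst (Δ ∣_) (trans d≡ (sym (trans (cong (weight L) (sym (++[] x))) const))) Δ∣d
    where
    d≡ : q * d' ≡ q ^ 1 * d'
    d≡ = cong (_* d') (sym (*-identityʳ q))
    ++[] : ∀ (x : V 2) → x ++ [] ≡ x
    ++[] (a ∷ b ∷ []) = refl
    const : weight L (x ++ 0ⱽ {0}) ≡ q ^ 1 * d'
    const = constant-weight 1 {0} d' L (subst (λ y → MinWt y L) d≡ (Griesmer.minWt G))
      (subst (λ y → prefixSupport 2 L ≤ griesmer q 2 y) d≡ (≤-trans support (Griesmer.short G))) x x≢0
      where
      support : prefixSupport 2 L ≤ length L
      support = ≤-trans (∑-mono L (λ c → ⟦⟧≤1 (¬? (take 2 c ≟ⱽ 0ⱽ))))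
        (≤-reflexive (trans (∑-const L 1) (*-identityʳ (length L))))

  module _ (p f : ℕ) (q≡p^f : q ≡ p ^ f) (1≤f : 1 ≤ f)
           (small : ∀ k d j → 1 ≤ k → k ≤ suc ρ → 1 ≤ d → p ^ (f + j) ∣ d → Divisible (p ^ suc j) k d) where

    divide-q : ∀ {j d} → 1 ≤ d → p ^ (f + j) ∣ d → ∃ λ d' → d ≡ q * d' × 1 ≤ d' × p ^ j ∣ d'
    divide-q {j} {d} 1≤d (divides n d≡) = n * p ^ j , eq , positive _ eq , n∣m*n n
      where
      eq : d ≡ q * (n * p ^ j)
      eq = trans d≡ (trans (cong (n *_) (trans (^-distribˡ-+-* p f j) (cong (_* p ^ j) (sym q≡p^f)))) (alg n q (p ^ j)))
        where
        alg : ∀ n q x → n * (q * x) ≡ q * (n * x)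
        alg = solve-∀
      positive : ∀ x → d ≡ q * x → 1 ≤ x
      positive zero    e = contradiction (≤-trans 1≤d (≤-reflexive (trans e (*-zeroʳ q)))) λ ()
      positive (suc x) e = s≤s z≤n

    p^suc-j : ∀ j → p ^ suc (f + j) ≡ q * p ^ suc j
    p^suc-j j = trans (cong (p ^_) (sym (+-suc f j))) (trans (^-distribˡ-+-* p f (suc j)) (cong (_* p ^ suc j) (sym q≡p^f)))

    -- `j` and `d` vary in the induction on `k`, because residual codes call for exponent j - f and
    -- distance d/q.
    divisible : ∀ k j d → 1 ≤ d → p ^ (f + j) ∣ d → Divisible (p ^ suc j) k d
    divisible zero j d 1≤d p∣d L G [] = subst (p ^ suc j ∣_) (sym (weight-0 L)) (_ ∣0)
    divisible (suc k) j d 1≤d p∣d with suc k ≤? suc ρ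
    ... | yes k≤ρ = small (suc k) d j (s≤s z≤n) k≤ρ 1≤d p∣d
    ... | no k≰ρ with suc j ≤? f
    ...   | yes j<f = divisible-small (subst (p ^ suc j ∣_) (sym q≡p^f) (m≤n⇒m^n∣o^n j<f))
              (≤-trans (≤-reflexive q≡2+ρ) (≰⇒> k≰ρ)) 1≤d (divisible k j d 1≤d p∣d)
      where
      m≤n⇒m^n∣o^n : ∀ {m n} → m ≤ n → p ^ m ∣ p ^ n
      m≤n⇒m^n∣o^n {m} {n} m≤n = divides (p ^ (n ∸ m))
        (trans (cong (p ^_) (sym (m∸n+n≡m m≤n))) (^-distribˡ-+-* p (n ∸ m) m))
    ...   | no j≮f = large k k≰ρ (j ∸ f) (m+[n∸m]≡n (≮⇒≥ j≮f)) (divisible k)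
      where
      large : ∀ k → ¬ suc k ≤ suc ρ → ∀ j' → f + j' ≡ j →
              (∀ j d → 1 ≤ d → p ^ (f + j) ∣ d → Divisible (p ^ suc j) k d) → Divisible (p ^ suc j) (suc k) d
      -- Dimension one always falls under the hypothesis, as q - 1 ≥ 1.
      large zero k≰ρ _ _ _ = contradiction (s≤s z≤n) k≰ρ
      large (suc k) _ j' refl IH with divide-q {f + j'} 1≤d p∣d
      ... | d₁ , refl , 1≤d₁ , p∣d₁ with divide-q {j'} 1≤d₁ p∣d₁
      ...   | d₂ , refl , 1≤d₂ , p∣d₂ = by-dimension k IH
        where
        -- From f ≥ 1 follows j + 1 ≤ f + j.
        Δ∣d : p ^ suc (f + j') ∣ q * (q * d₂)
        Δ∣d = ∣-trans (divides (p ^ (f ∸ 1)) (trans (cong (λ x → p ^ (x + (f + j'))) (sym (m∸n+n≡m 1≤f)))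
                (trans (cong (p ^_) (alg (f ∸ 1) (f + j'))) (^-distribˡ-+-* p (f ∸ 1) (suc (f + j')))))) p∣d
          where
          alg : ∀ a b → a + 1 + b ≡ a + (1 + b)
          alg = solve-∀
        by-dimension : ∀ k → (∀ j d → 1 ≤ d → p ^ (f + j) ∣ d → Divisible (p ^ suc j) (suc k) d) →
                       Divisible (p ^ suc (f + j')) (2 + k) (q * (q * d₂))
        by-dimension zero    _  = divisible-plane Δ∣d
        by-dimension (suc k) IH = divisible-large 1≤d₂ Δ∣d (∣-reflexive (p^suc-j j'))
          (IH (f + j') (q * (q * d₂)) 1≤d p∣d) (IH j' (q * d₂) 1≤d₁ p∣d₁)

-- The field structure transported along enum to Fin q, where equality is propositional.
module Transport {c ℓ : Level} {q : ℕ} (𝕜 : FiniteField c ℓ q) where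

  open FiniteField 𝕜 using (Carrier; _≈_; 0#; 1#; commRing; isCommutativeRing; 1≉0; enum; enum-sur; enum-inj; reflexive; +-cong; *-cong; *-congˡ; *-congʳ)
    renaming (_+_ to _+ₖ_; _*_ to _*ₖ_; -_ to -ₖ_; _≟_ to _≟ₖ_; inverse to inverseₖ; refl to ≈-refl; sym to ≈-sym; trans to ≈-trans)

  index : Carrier → Fin q
  index a = proj₁ (enum-sur a)

  enum-index : ∀ a → enum (index a) ≈ a
  enum-index a = proj₂ (enum-sur a)

  index-≡ : ∀ {a i} → enum i ≈ a → index a ≡ i
  index-≡ {a} {i} e = enum-inj (index a) i (≈-trans (enum-index a) (≈-sym e))

  finRawRing : RawRing 0ℓ 0ℓ
  finRawRing = record
    { Carrier = Fin q ; _≈_ = _≡_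
    ; _+_ = λ i j → index (enum i +ₖ enum j) ; _*_ = λ i j → index (enum i *ₖ enum j)
    ; -_ = λ i → index (-ₖ enum i) ; 0# = index 0# ; 1# = index 1# }

  -- The operations on indices are chosen so that `enum` preserves them; by injectivity the ring
  -- laws pull back and become propositional equalities.
  enum-mono : IsRingMonomorphism finRawRing (CommutativeRing.rawRing commRing) enum
  enum-mono = record
    { isRingHomomorphism = record
      { isSemiringHomomorphism = record
        { isNearSemiringHomomorphism = record
          { +-isMonoidHomomorphism = record
            { isMagmaHomomorphism = record
              { isRelHomomorphism = record { cong = λ { refl → ≈-refl } }
              ; homo = λ i j → enum-index _ }
            ; ε-homo = enum-index _ }
          ; *-homo = λ i j → enum-index _ }
        ; 1#-homo = enum-index _ }
      ; -‿homo = λ i → enum-index _ }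
    ; injective = enum-inj _ _ }

  field-on-Fin : FinField q
  field-on-Fin = record
    { _⊕_ = RawRing._+_ finRawRing ; _⊗_ = RawRing._*_ finRawRing ; ⊖_ = RawRing.-_ finRawRing
    ; 0F = index 0# ; 1F = index 1#
    ; isCommutativeRing = RingMonomorphism.isCommutativeRing enum-mono isCommutativeRing
    ; 1≢0 = λ e → 1≉0 (≈-trans (≈-sym (enum-index 1#)) (≈-trans (reflexive (cong enum e)) (enum-index 0#)))
    ; inverse = λ a a≢0 → let b , ab≈1 = inverseₖ (enum a) (λ a≈0 → a≢0 (sym (index-≡ a≈0))) in
        index b , enum-inj _ _ (≈-trans (enum-index _) (≈-trans (*-congˡ (enum-index b)) (≈-trans ab≈1 (≈-sym (enum-index 1#)))))
    }

  -- Translation between generator matrices and lists of columns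

  module Codewords (ρ : ℕ) (q≡2+ρ : q ≡ 2 + ρ) where

    open FinField field-on-Fin using (0F; 1F)
    open CodesOver q ρ q≡2+ρ field-on-Fin

    enum-∙ : ∀ {k} (x y : V k) → enum (x ∙ y) ≈ sumF 𝕜 k (λ i → enum (lookup x i) *ₖ enum (lookup y i))
    enum-∙ []      []      = enum-index 0#
    enum-∙ (a ∷ x) (b ∷ y) = ≈-trans (enum-index _) (+-cong (enum-index _) (enum-∙ x y))

    sumF-cong : ∀ k {f g : Fin k → Carrier} → (∀ i → f i ≈ g i) → sumF 𝕜 k f ≈ sumF 𝕜 k g
    sumF-cong zero    h = ≈-refl
    sumF-cong (suc k) h = +-cong (h Fin.zero) (sumF-cong k (λ i → h (Fin.suc i)))

    indexV : ∀ {k} → (Fin k → Carrier) → V k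
    indexV x = Vec.tabulate (λ i → index (x i))

    enum-indexV : ∀ {k} (x : Fin k → Carrier) i → enum (lookup (indexV x) i) ≈ x i
    enum-indexV x i = ≈-trans (reflexive (cong enum (lookup∘tabulate _ i))) (enum-index (x i))

    weight-tabulate : ∀ {n k} (cols : Fin n → V k) x (v : Fin n → Carrier) → (∀ j → v j ≈ enum (x ∙ cols j)) →
                  wt 𝕜 v ≡ weight (List.tabulate cols) x
    weight-tabulate {zero}  cols x v h = refl
    weight-tabulate {suc n} cols x v h with v Fin.zero ≟ₖ 0#
    ... | yes v₀≈0 = cong₂ _+_ {y = nz (x ∙ cols Fin.zero)}
            (sym (trans (cong nz (trans (sym (index-≡ (≈-sym (h Fin.zero)))) (index-≡ (≈-trans (enum-index 0#) (≈-sym v₀≈0))))) nz-0))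
            (weight-tabulate (cols ∘ Fin.suc) x (v ∘ Fin.suc) (h ∘ Fin.suc))
    ... | no v₀≉0 = cong₂ _+_ {y = nz (x ∙ cols Fin.zero)}
            (sym (nz-≢0 (λ e → v₀≉0 (≈-trans (h Fin.zero) (≈-trans (reflexive (cong enum e)) (enum-index 0#))))))
            (weight-tabulate (cols ∘ Fin.suc) x (v ∘ Fin.suc) (h ∘ Fin.suc))

    lookup-0 : ∀ {k} (i : Fin k) → lookup 0ⱽ i ≡ 0F
    lookup-0 Fin.zero    = refl
    lookup-0 (Fin.suc i) = lookup-0 i

    ≡0⇐lookup : ∀ {k} (x : V k) → (∀ i → lookup x i ≡ 0F) → x ≡ 0ⱽ
    ≡0⇐lookup []      h = refl
    ≡0⇐lookup (a ∷ x) h = cong₂ _∷_ (h Fin.zero) (≡0⇐lookup x (λ i → h (Fin.suc i)))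

    indexV-0 : ∀ {k} (x : Fin k → Carrier) → indexV x ≡ 0ⱽ → IsZeroVec 𝕜 x
    indexV-0 x e i = ≈-trans (≈-sym (enum-indexV x i))
      (≈-trans (reflexive (cong enum (trans (cong (λ y → lookup y i) e) (lookup-0 i)))) (enum-index 0#))

    weight≢0⇒nonzero : ∀ {n k} (cols : Fin n → V k) x (v : Fin n → Carrier) → (∀ j → v j ≈ enum (x ∙ cols j)) →
                    1 ≤ weight (List.tabulate cols) x → ¬ IsZeroVec 𝕜 v
    weight≢0⇒nonzero cols x v h 1≤wt zero-v = contradiction (subst (1 ≤_) (go cols v h zero-v) 1≤wt) λ ()
      where
      go : ∀ {n} (cols : Fin n → V _) v → (∀ j → v j ≈ enum (x ∙ cols j)) → IsZeroVec 𝕜 v →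
           weight (List.tabulate cols) x ≡ 0
      go {zero}  cols v h z = refl
      go {suc n} cols v h z = cong₂ _+_
        (trans (cong nz (trans (sym (index-≡ ≈-refl))
          (index-≡ (≈-trans (enum-index 0#) (≈-trans (≈-sym (z Fin.zero)) (h Fin.zero)))))) nz-0)
        (go (cols ∘ Fin.suc) (v ∘ Fin.suc) (h ∘ Fin.suc) (z ∘ Fin.suc))

    columns : ∀ {n k} → LinearCode 𝕜 n k → Cols k
    columns C = List.tabulate (λ j → indexV (λ i → LinearCode.G C i j))

    weight-codeword : ∀ {n k} (C : LinearCode 𝕜 n k) x v → (∀ j → v j ≈ LinearCode.encode C x j) →
                  wt 𝕜 v ≡ weight (columns C) (indexV x)
    weight-codeword {n} {k} C x v h = weight-tabulate _ (indexV x) v (λ j → ≈-trans (h j)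
      (≈-sym (≈-trans (enum-∙ (indexV x) (indexV (λ i → LinearCode.G C i j)))
        (sumF-cong k (λ i → *-cong (enum-indexV x i) (enum-indexV (λ i → LinearCode.G C i j) i))))))

    Code⇒Griesmer : ∀ {k d} → (C : Code 𝕜 (griesmer q k d) k d) → Griesmer k d (columns (Code.lin C))
    Code⇒Griesmer {k} {d} C = record
      { minWt = λ x x≢0 → subst (d ≤_)
          (trans (weight-codeword lin (enum ∘ lookup x) (word (enum ∘ lookup x)) (λ _ → ≈-refl))
            (cong (weight (columns lin)) (index-enum x)))
          (Code.min-wt C _ (enum ∘ lookup x , λ _ → ≈-refl)
            (λ zero-word → x≢0 (≡0⇐lookup x (λ i → sym (index-≡ (independent (enum ∘ lookup x) zero-word i))))))
      ; short = ≤-reflexive (length-tabulate _)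
      }
      where
      open LinearCode (Code.lin C) using () renaming (encode to word; rows-indep to independent)
      lin = Code.lin C
      index-enum : ∀ {k} (x : V k) → indexV (enum ∘ lookup x) ≡ x
      index-enum []      = refl
      index-enum (a ∷ x) = cong₂ _∷_ (index-≡ ≈-refl) (index-enum x)

    -- Deleting a zero column would beat the Griesmer bound.
    Griesmer⇒nonzero : ∀ {k d} {L : Cols k} → Griesmer k d L → ∀ {c} → c ∈ L → c ≢ 0ⱽ
    Griesmer⇒nonzero {k} {d} {L} G c∈L refl = <⇒≱
      (filter-notAll (λ c → ¬? (c ≟ⱽ 0ⱽ)) L (Any.map (λ { refl ne → ne refl }) c∈L))
      (≤-trans (Griesmer.short G) (griesmer-bound k L' (λ x x≢0 → subst (d ≤_) (sym (weight-L' x)) (Griesmer.minWt G x x≢0))))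
      where
      L' : Cols k
      L' = filter (λ c → ¬? (c ≟ⱽ 0ⱽ)) L
      weight-L' : ∀ x → weight L' x ≡ weight L x
      weight-L' x = ∑-filter (λ c → ¬? (c ≟ⱽ 0ⱽ)) L (λ c → nz (x ∙ c)) (λ c ¬ne → trans
        (cong (λ y → nz (x ∙ y)) (decidable-stable (c ≟ⱽ 0ⱽ) ¬ne)) (trans (cong nz (∙-0ʳ x)) nz-0))

    module FromColumns {k d n} (cols : Fin n → V (suc k)) (1≤d : 1 ≤ d)
                       (G : Griesmer (suc k) d (List.tabulate cols)) where

      private
        Gen : Fin (suc k) → Fin n → Carrier
        Gen i j = enum (lookup (cols j) i)

        encodeG : (Fin (suc k) → Carrier) → Fin n → Carrier
        encodeG x j = sumF 𝕜 (suc k) (λ i → x i *ₖ Gen i j)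

        encodeG-≈ : ∀ x j → encodeG x j ≈ enum (indexV x ∙ cols j)
        encodeG-≈ x j = ≈-sym (≈-trans (enum-∙ (indexV x) (cols j))
          (sumF-cong (suc k) (λ i → *-congʳ {enum (lookup (cols j) i)} (enum-indexV x i))))

        encode-enum : ∀ (y : V (suc k)) j → encodeG (enum ∘ lookup y) j ≈ enum (y ∙ cols j)
        encode-enum y j = ≈-sym (enum-∙ y (cols j))

      lin : LinearCode 𝕜 n (suc k)
      lin = record
        { G = Gen
        ; rows-indep = λ x zero-word → indexV-0 x (decidable-stable (indexV x ≟ⱽ 0ⱽ) (λ x≢0 →
            weight≢0⇒nonzero cols (indexV x) _ (encodeG-≈ x) (≤-trans 1≤d (Griesmer.minWt G _ x≢0)) zero-word))
        }

      -- The way back to the hypothesis of the theorem, which speaks of `Code`. Nonzero messages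
      -- have weight at least d ≥ 1, so the rows are independent; no column of a Griesmer code is
      -- zero, so each coordinate is hit by some word.
      code : Code 𝕜 n (suc k) d
      code = record
        { lin = lin
        ; min-wt = λ { v (x , v≈) v≉0 → subst (d ≤_)
            (sym (weight-tabulate cols (indexV x) v (λ j → ≈-trans (v≈ j) (encodeG-≈ x j))))
            (Griesmer.minWt G (indexV x) (λ e → v≉0 (λ j → ≈-trans (v≈ j) (≈-trans (encodeG-≈ x j)
              (≈-trans (reflexive (cong enum (trans (cong (_∙ cols j) e) (∙-0ˡ (cols j))))) (enum-index 0#)))))) }
        ; attains = attained (Griesmer-attained G)
        ; full-len = λ j → covering j (∃-∙≡1 (cols j) (Griesmer⇒nonzero G (∈-tabulate⁺ j)))
        }
        where
        attained : (∃ λ y → y ≢ 0ⱽ × weight (List.tabulate cols) y ≡ d) →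
                   Σ (Fin n → Carrier) (λ v → _∈C lin v × ¬ IsZeroVec 𝕜 v × wt 𝕜 v ≡ d)
        attained (y , y≢0 , wt≡d) = encodeG (enum ∘ lookup y) , (enum ∘ lookup y , λ _ → ≈-refl) ,
          weight≢0⇒nonzero cols y _ (encode-enum y) (subst (1 ≤_) (sym wt≡d) 1≤d) ,
          trans (weight-tabulate cols y _ (encode-enum y)) wt≡d
        covering : ∀ j → (∃ λ w → w ∙ cols j ≡ 1F) → Σ (Fin n → Carrier) (λ v → _∈C lin v × ¬ (v j ≈ 0#))
        covering j (w , w∙≡1) = encodeG (enum ∘ lookup w) , (enum ∘ lookup w , λ _ → ≈-refl) ,
          λ v≈0 → 1≉0 (≈-trans (≈-sym (≈-trans (encode-enum w j) (≈-trans (reflexive (cong enum w∙≡1)) (enum-index 1#)))) v≈0)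

      codeword-wt : ∀ y → Σ (Fin n → Carrier) λ v → _∈C lin v × wt 𝕜 v ≡ weight (List.tabulate cols) y
      codeword-wt y = encodeG (enum ∘ lookup y) , (enum ∘ lookup y , λ _ → ≈-refl) ,
        weight-tabulate cols y _ (encode-enum y)

    fromList : ∀ {k d n} (L : Cols (suc k)) → length L ≡ n → 1 ≤ d → Griesmer (suc k) d L →
               Σ (Code 𝕜 n (suc k) d) λ C → ∀ y → Σ (Fin n → Carrier) λ v → _∈C (Code.lin C) v × wt 𝕜 v ≡ weight L y
    fromList {k} {d} L refl 1≤d G = code , λ y → let v , v∈C , wt≡ = codeword-wt y in
        v , v∈C , trans wt≡ (cong (λ L → weight L y) (tabulate-lookup L))
      where
      open FromColumns {k} {d} (List.lookup L) 1≤d (subst (Griesmer (suc k) d) (sym (tabulate-lookup L)) G)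

    divProp⇒Divisible : ∀ {p k d e Δ} → 1 ≤ d → p ^ e ∣ d → q ≤ p ^ e → Δ * q ≡ p ^ suc e →
      ((C : Code 𝕜 (griesmer q (suc k) d) (suc k) d) → DivProp 𝕜 p (griesmer q (suc k) d) (suc k) d C) →
      Divisible Δ (suc k) d
    divProp⇒Divisible {e = e} {Δ} 1≤d pᵉ∣d q≤pᵉ Δq≡ hyp L G x with fromList L (Griesmer.exact G) 1≤d G
    ... | C , words with words x
    ...   | v , v∈C , wt≡ = subst (Δ ∣_) wt≡ (hyp C e pᵉ∣d q≤pᵉ Δ Δq≡ v v∈C)

-- Exponents of p, and the conclusion for arbitrary dimension

module _ {c ℓ : Level} (p f : ℕ) (p-prime : Prime p) (1≤f : 1 ≤ f) where

  private
    1<p : 1 < p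
    1<p = nonTrivial⇒n>1 p {{prime⇒nonTrivial p-prime}}

    instance
      p-nonZero : NonZero p
      p-nonZero = >-nonZero (<⇒≤ 1<p)

  lift-divisibility : ∀ q ρ → q ≡ 2 + ρ → q ≡ p ^ f → (𝕜 : FiniteField c ℓ q) →
    ((k d : ℕ) → 1 ≤ k → k ≤ q ∸ 1 → 1 ≤ d → (C : Code 𝕜 (griesmer q k d) k d) → DivProp 𝕜 p (griesmer q k d) k d C) →
    (k d : ℕ) → 1 ≤ k → 1 ≤ d → (C : Code 𝕜 (griesmer q k d) k d) → DivProp 𝕜 p (griesmer q k d) k d C
  lift-divisibility q ρ q≡2+ρ q≡p^f 𝕜 hyp k d 1≤k 1≤d C e pᵉ∣d q≤pᵉ m mq≡ v (x , v≈) =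
    subst₂ _∣_ (sym m≡) (sym (weight-codeword (Code.lin C) x v v≈))
      (divisible p f q≡p^f 1≤f small k j d 1≤d (subst (λ y → p ^ y ∣ d) e≡ pᵉ∣d) _ (Code⇒Griesmer C) (indexV x))
    where
    open Transport 𝕜
    open Codewords ρ q≡2+ρ
    open CodesOver q ρ q≡2+ρ field-on-Fin using (Divisible; divisible)
    f≤e : f ≤ e
    f≤e = ≮⇒≥ λ e<f → <⇒≱ (^-monoʳ-< p 1<p e<f) (≤-trans (≤-reflexive (sym q≡p^f)) q≤pᵉ)
    j : ℕ
    j = e ∸ f
    e≡ : e ≡ f + j
    e≡ = sym (m+[n∸m]≡n f≤e)
    power : ∀ j → p ^ suc j * q ≡ p ^ suc (f + j)
    power j = trans (cong (p ^ suc j *_) q≡p^f) (trans (sym (^-distribˡ-+-* p (suc j) f))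
      (cong (λ y → p ^ suc y) (+-comm j f)))
    -- Cancelling q identifies the quotient p^(e+1)/q with Δ.
    m≡ : m ≡ p ^ suc j
    m≡ = *-cancelʳ-≡ _ _ q {{>-nonZero (subst (0 <_) (sym q≡2+ρ) (s≤s z≤n))}}
      (trans mq≡ (trans (cong (λ y → p ^ suc y) e≡) (sym (power j))))
    small : ∀ k d j → 1 ≤ k → k ≤ suc ρ → 1 ≤ d → p ^ (f + j) ∣ d → Divisible (p ^ suc j) k d
    small (suc k) d j 1≤k k≤ρ 1≤d p∣d = divProp⇒Divisible {e = f + j} 1≤d p∣d
      (≤-trans (≤-reflexive q≡p^f) (^-monoʳ-≤ p (m≤m+n f j))) (power j)
      (hyp (suc k) d 1≤k (≤-trans k≤ρ (≤-reflexive (cong pred (sym q≡2+ρ)))) 1≤d)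

theorem6p3 : {c ℓ : Level} (p f : ℕ) → Prime p → 1 ≤ f →
    (F : FiniteField c ℓ (p ^ f)) →
    ((k d : ℕ) → 1 ≤ k → k ≤ p ^ f ∸ 1 → 1 ≤ d →
    (C : Code F (griesmer (p ^ f) k d) k d) →
    DivProp F p (griesmer (p ^ f) k d) k d C) →
    (k d : ℕ) → 1 ≤ k → 1 ≤ d →
    (C : Code F (griesmer (p ^ f) k d) k d) →
    DivProp F p (griesmer (p ^ f) k d) k d C
theorem6p3 p f p-prime 1≤f F = lift-divisibility p f p-prime 1≤f (p ^ f) (p ^ f ∸ 2)
  (sym (m+[n∸m]≡n 2≤p^f)) refl F
  where
  1<p : 1 < p
  1<p = nonTrivial⇒n>1 p {{prime⇒nonTrivial p-prime}}
  -- Makes `p ^ f ∸ 2`, the value taken for `ρ`, a genuine difference.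
  2≤p^f : 2 ≤ p ^ f
  2≤p^f = ≤-trans 1<p (≤-trans (≤-reflexive (sym (^-identityʳ p))) (^-monoʳ-≤ p {{>-nonZero (<⇒≤ 1<p)}} 1≤f))
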